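{- We have $$\sum_{n=0}^\infty\big(q^{n(n+1)}-q^{5n(n+1)+1}\big)=\frac{(q,q^9,q^{10};q^{10})_\infty\,(q^8,q^{12};q^{20})_\infty}{(q^2,q^3;q^5)_\infty}.$$
   Context: Here $q$ is a complex number with $|q|<1$ (equivalently, the identity may be read as an identity of formal power series in $q$). For a complex number $a$, $(a;q)_\infty:=\prod_{i=0}^\infty(1-aq^i)$, and $(a_1,a_2,\dots,a_m;q)_\infty:=\prod_{j=1}^m(a_j;q)_\infty$. -}

module Defs where

-- Formal power series in q with integer coefficients, as coefficient
-- functions  f : ℕ → ℤ  (f n = coefficient of q^n).

open import Data.Nat as ℕ using (ℕ; zero; suc; _≡ᵇ_; _∸_)
open import Data.Integer as ℤ using (ℤ; 0ℤ; 1ℤ)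
open import Data.List using (List; upTo; map; foldr)
open import Data.Bool.ListAction using (any)
open import Data.Bool using (Bool; if_then_else_)

PS : Set
PS = ℕ → ℤ

Σ< : ℕ → (ℕ → ℤ) → ℤ
Σ< m g = foldr ℤ._+_ 0ℤ (map g (upTo m))

one : PS
one zero = 1ℤ
one (suc _) = 0ℤ

mono : ℕ → PS
mono e n = if e ≡ᵇ n then 1ℤ else 0ℤ

_⊕_ : PS → PS → PS
(f ⊕ g) n = f n ℤ.+ g n

_⊖_ : PS → PS → PS
(f ⊖ g) n = f n ℤ.- g n

_⊛_ : PS → PS → PS
(f ⊛ g) n = Σ< (suc n) (λ k → f k ℤ.* g (n ∸ k))

infixl 7 _⊛_
infixl 6 _⊕_ _⊖_

Π< : ℕ → (ℕ → PS) → PS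
Π< zero F = one
Π< (suc m) F = Π< m F ⊛ F m

-- geometric series 1/(1 - q^m) = Σ_j q^(m j)   (used for m ≥ 1)
geom : ℕ → PS
geom m n = if any (λ j → (m ℕ.* j) ≡ᵇ n) (upTo (suc n)) then 1ℤ else 0ℤ

-- (q^a; q^k)_∞ = Π_{i≥0} (1 - q^(a + k i)), for a ≥ 1, k ≥ 1.
-- Coefficient of q^n only depends on the factors with i ≤ n
-- (since a + k i ≥ i + 1 > n for i ≥ n), so we truncate there.
poch : ℕ → ℕ → PS
poch a k n = Π< (suc n) (λ i → one ⊖ mono (a ℕ.+ k ℕ.* i)) n

-- 1/(q^a; q^k)_∞ = Π_{i≥0} 1/(1 - q^(a + k i)), for a ≥ 1, k ≥ 1,
-- truncated in the same way.
invPoch : ℕ → ℕ → PS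
invPoch a k n = Π< (suc n) (λ i → geom (a ℕ.+ k ℕ.* i)) n

-- Σ_{n≥0} (q^{n(n+1)} - q^{5n(n+1)+1}); the n-th term has no
-- coefficient in degrees < n, so degree N only needs n ≤ N.
lhs14 : PS
lhs14 N = Σ< (suc N) (λ n → (mono (n ℕ.* suc n) ⊖ mono (5 ℕ.* (n ℕ.* suc n) ℕ.+ 1)) N)

rhs14 : PS
rhs14 = poch 1 10 ⊛ poch 9 10 ⊛ poch 10 10 ⊛ poch 8 20 ⊛ poch 12 20
        ⊛ invPoch 2 5 ⊛ invPoch 3 5

{-# OPTIONS --safe #-}

-- The left side is ψ(q²) - q ψ(q¹⁰) with ψ(q) = Σ q^(n(n+1)/2). Write Θₖ = (qᵏ, q²⁰⁻ᵏ; q²⁰)_∞. Gauss' product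
-- ψ(q) = (q²; q²)_∞ / (q; q²)_∞ turns the claim into the three-term relation
--   Θ₇ Θ₃ Θ₈ Θ₄ - Θ₁₀ Θ₆ Θ₉ Θ₁ = q Θ₇ Θ₃ Θ₆ Θ₂,
-- an instance of Weierstrass' identity. By the Jacobi triple product each Θₖ is a theta series up to
-- (q²⁰; q²⁰)_∞; splitting the double series of a product of two thetas by the parity of m + n gives
-- θ(x y) θ(x / y) = P(x) Q(y) - (x / y) Q(x) P(y), and the three-term relation becomes Plücker's.
-- The triple product itself is the limit of its finite form with Gaussian binomial coefficients.
-- Everything is carried out modulo q^N, in a commutative ring with an element q whose powers q^e, e ≥ N,
-- vanish, so that all sums and products are finite.
module Submission where

import Algebra.Properties.Semiring.Exp as Exp
import Algebra.Solver.Ring as RingSolver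
open import Algebra.Bundles using (CommutativeRing)
open import Algebra.Solver.Ring.AlmostCommutativeRing using (fromCommutativeRing; _-Raw-AlmostCommutative⟶_)
open import Data.Bool as Bool using (true; false; if_then_else_)
open import Data.Empty using (⊥-elim)
open import Data.Integer as ℤ using (ℤ; +_; -[1+_]; ∣_∣; 0ℤ; 1ℤ)
import Data.Integer.Properties as ℤ
import Data.Integer.Solver as ℤ
open import Data.List using (upTo; foldr)
open import Data.List.Membership.Propositional using (lose; find)
open import Data.List.Membership.Propositional.Properties using (∈-upTo⁺)
open import Data.List.Properties using (map-applyUpTo; map-upTo)
open import Data.List.Relation.Unary.Any.Properties using (any⁺; any⁻)
import Data.Maybe as Maybe
open import Data.Nat as ℕ using (ℕ; zero; suc; _∸_; _≤_; _<_; z≤n; s≤s; _≡ᵇ_)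
open import Data.Nat.Divisibility using (_∣_; _∤_; _∣?_; divides; ∣m+n∣m⇒∣n; ∣m∣n⇒∣m+n; ∣-refl; _∣0; >⇒∤)
import Data.Nat.Properties as ℕ
import Data.Nat.Solver as ℕ
open import Data.Product using (Σ; _,_)
open import Data.Sum using (inj₁; inj₂; [_,_]′)
open import Function using (case_of_)
open import Level using (0ℓ)
open import Relation.Binary.PropositionalEquality as ≡ using (_≡_; _≢_)
open import Relation.Nullary using (¬_; yes; no)
open import Relation.Nullary.Decidable using (dec⇒maybe)

-- The element q is nilpotent, so it has no negative powers, and division is possible only by units
-- such as 1 - q^e with e ≥ 1. This shapes most statements below. A bilateral series in A with base
-- p carries a second parameter B with A B = p in place of p / A; quotients of q-factorials are
-- cross-multiplied; a theta series is given by two natural exponents a, b whose sum is the period.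
-- In exchange limits are exact: a product of N factors already is the infinite one, and a Gaussian
-- coefficient at distance at least N from both ends of its row is the inverse of (p; p)_∞. The
-- period 20 is a common modulus: the products in base 4, 5 and 10 that occur all split into residue
-- classes modulo 20. The arguments of Weierstrass' identity are read off from the first product: x
-- y, x / y, u v, u / v = q^13, q^3, q^8, q^4 (with Θ₁₃ = Θ₇) force x, y, u, v = q^8, q^5, q^6, q^2,
-- and the other two products then get the exponents 10, 6, 11, 1 and 7, 3, 14, 2.

-- Integer coefficients for the ring solver over an arbitrary commutative ring

module IntegerCoefficients {c ℓ} (R : CommutativeRing c ℓ) where
  open CommutativeRing R hiding (zero)
  open import Algebra.Properties.Ring ring
  open import Algebra.Properties.AbelianGroup +-abelianGroup using (⁻¹-∙-comm)
  open import Algebra.Properties.Semiring.Mult.TCOptimised semiring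
  open import Algebra.Properties.CommutativeSemigroup +-commutativeSemigroup using (interchange)
  open import Relation.Binary.Reasoning.Setoid setoid

  -- The optimised multiples make `fromℤ (+ 1)` reduce to `1#`, so constants in solver equations
  -- match the literals `0#` and `1#` definitionally. Coefficients are integers because they need a
  -- decidable equality, which `R` does not provide.
  fromℤ : ℤ → Carrier
  fromℤ (+ n)    = n × 1#
  fromℤ -[1+ n ] = - (suc n × 1#)

  fromℤ-⊖ : ∀ m n → fromℤ (m ℤ.⊖ n) ≈ m × 1# - n × 1#
  fromℤ-⊖ m zero = begin
    m × 1#          ≈⟨ +-identityʳ _ ⟨
    m × 1# + 0#     ≈⟨ +-congˡ -0#≈0# ⟨
    m × 1# - 0#     ∎
  fromℤ-⊖ zero (suc n) = sym (+-identityˡ _)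
  fromℤ-⊖ (suc m) (suc n) = begin
    fromℤ (suc m ℤ.⊖ suc n)              ≡⟨ ≡.cong fromℤ (ℤ.[1+m]⊖[1+n]≡m⊖n m n) ⟩
    fromℤ (m ℤ.⊖ n)                      ≈⟨ fromℤ-⊖ m n ⟩
    m × 1# - n × 1#                      ≈⟨ +-identityˡ _ ⟨
    0# + (m × 1# - n × 1#)               ≈⟨ +-congʳ (-‿inverseʳ 1#) ⟨
    (1# - 1#) + (m × 1# - n × 1#)        ≈⟨ interchange _ _ _ _ ⟩
    (1# + m × 1#) + (- 1# - n × 1#)      ≈⟨ +-congˡ (⁻¹-∙-comm _ _) ⟩
    (1# + m × 1#) - (1# + n × 1#)        ≈⟨ +-cong (1+× m 1#) (-‿cong (1+× n 1#)) ⟨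
    suc m × 1# - suc n × 1#              ∎

  fromℤ-+ : ∀ i j → fromℤ (i ℤ.+ j) ≈ fromℤ i + fromℤ j
  fromℤ-+ (+ m) (+ n) = ×-homo-+ 1# m n
  fromℤ-+ (+ m) -[1+ n ] = fromℤ-⊖ m (suc n)
  fromℤ-+ -[1+ m ] (+ n) = trans (fromℤ-⊖ n (suc m)) (+-comm _ _)
  fromℤ-+ -[1+ m ] -[1+ n ] = begin
    - (suc (suc (m ℕ.+ n)) × 1#)         ≡⟨ ≡.cong (λ k → - (suc k × 1#)) (ℕ.+-suc m n) ⟨
    - ((suc m ℕ.+ suc n) × 1#)           ≈⟨ -‿cong (×-homo-+ 1# (suc m) (suc n)) ⟩
    - (suc m × 1# + suc n × 1#)          ≈⟨ ⁻¹-∙-comm _ _ ⟨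
    - (suc m × 1#) - (suc n × 1#)        ∎

  fromℤ-neg : ∀ i → fromℤ (ℤ.- i) ≈ - fromℤ i
  fromℤ-neg (+ zero)  = sym -0#≈0#
  fromℤ-neg (+ suc n) = refl
  fromℤ-neg -[1+ n ]  = sym (-‿involutive _)

  fromℤ-+*+ : ∀ m n → fromℤ (+ m ℤ.* + n) ≈ m × 1# * n × 1#
  fromℤ-+*+ m n = begin
    fromℤ (+ m ℤ.* + n)   ≡⟨ ≡.cong fromℤ (ℤ.pos-* m n) ⟨
    (m ℕ.* n) × 1#        ≈⟨ ×1-homo-* m n ⟩
    m × 1# * n × 1#       ∎

  fromℤ-+* : ∀ m j → fromℤ (+ m ℤ.* j) ≈ m × 1# * fromℤ j
  fromℤ-+* m (+ n) = fromℤ-+*+ m n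
  fromℤ-+* m -[1+ n ] = begin
    fromℤ (+ m ℤ.* -[1+ n ])       ≡⟨ ≡.cong fromℤ (ℤ.neg-distribʳ-* (+ m) (+ suc n)) ⟨
    fromℤ (ℤ.- (+ m ℤ.* + suc n))  ≈⟨ fromℤ-neg (+ m ℤ.* + suc n) ⟩
    - fromℤ (+ m ℤ.* + suc n)      ≈⟨ -‿cong (fromℤ-+*+ m (suc n)) ⟩
    - (m × 1# * suc n × 1#)        ≈⟨ -‿distribʳ-* _ _ ⟩
    m × 1# * - (suc n × 1#)        ∎

  fromℤ-* : ∀ i j → fromℤ (i ℤ.* j) ≈ fromℤ i * fromℤ j
  fromℤ-* (+ m) j = fromℤ-+* m j
  fromℤ-* -[1+ m ] j = begin
    fromℤ (-[1+ m ] ℤ.* j)         ≡⟨ ≡.cong fromℤ (ℤ.neg-distribˡ-* (+ suc m) j) ⟨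
    fromℤ (ℤ.- (+ suc m ℤ.* j))    ≈⟨ fromℤ-neg (+ suc m ℤ.* j) ⟩
    - fromℤ (+ suc m ℤ.* j)        ≈⟨ -‿cong (fromℤ-+* (suc m) j) ⟩
    - (suc m × 1# * fromℤ j)       ≈⟨ -‿distribˡ-* _ _ ⟩
    - (suc m × 1#) * fromℤ j       ∎

  homomorphism : ℤ.+-*-rawRing -Raw-AlmostCommutative⟶ fromCommutativeRing R
  homomorphism = record
    { ⟦_⟧ = fromℤ ; +-homo = fromℤ-+ ; *-homo = fromℤ-* ; -‿homo = fromℤ-neg
    ; 0-homo = refl ; 1-homo = refl }

  open RingSolver ℤ.+-*-rawRing (fromCommutativeRing R) homomorphism
    (λ i j → Maybe.map (λ i≡j → reflexive (≡.cong fromℤ i≡j)) (dec⇒maybe (i ℤ.≟ j))) public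

-- Finite sums, finite products and units

module Sums {c ℓ} (R : CommutativeRing c ℓ) where
  open CommutativeRing R hiding (zero)
  open IntegerCoefficients R using (solve; _:+_; _:*_; _:-_; _:=_; con)
  open import Relation.Binary.Reasoning.Setoid setoid

  sum : ℕ → (ℕ → Carrier) → Carrier
  sum zero    f = 0#
  sum (suc n) f = sum n f + f n

  prod : ℕ → (ℕ → Carrier) → Carrier
  prod zero    f = 1#
  prod (suc n) f = prod n f * f n

  sum-cong : ∀ n {f g} → (∀ i → i < n → f i ≈ g i) → sum n f ≈ sum n g
  sum-cong zero    f≈g = refl
  sum-cong (suc n) f≈g =
    +-cong (sum-cong n λ i i<n → f≈g i (ℕ.m≤n⇒m≤1+n i<n)) (f≈g n (ℕ.n<1+n n))

  sum-+ : ∀ n f g → sum n (λ i → f i + g i) ≈ sum n f + sum n g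
  sum-+ zero    f g = sym (+-identityˡ 0#)
  sum-+ (suc n) f g = trans (+-congʳ (sum-+ n f g))
    (solve 4 (λ a b c d → (a :+ b) :+ (c :+ d) := (a :+ c) :+ (b :+ d)) refl _ _ _ _)

  sum-*ˡ : ∀ n a f → sum n (λ i → a * f i) ≈ a * sum n f
  sum-*ˡ zero    a f = sym (zeroʳ a)
  sum-*ˡ (suc n) a f = trans (+-congʳ (sum-*ˡ n a f)) (sym (distribˡ a _ _))

  sum-front : ∀ n f → sum (suc n) f ≈ f 0 + sum n (λ i → f (suc i))
  sum-front zero    f = +-comm _ _
  sum-front (suc n) f = trans (+-congʳ (sum-front n f)) (+-assoc _ _ _)

  sum-pairs : ∀ n f → sum (n ℕ.+ n) f ≈ sum n (λ i → f (i ℕ.+ i) + f (suc (i ℕ.+ i)))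
  sum-pairs zero    f = refl
  sum-pairs (suc n) f rewrite ℕ.+-suc n n =
    trans (+-assoc _ _ _) (+-congʳ (sum-pairs n f))

  sum-stable : ∀ k m f → (∀ i → m ≤ i → f i ≈ 0#) → sum (k ℕ.+ m) f ≈ sum m f
  sum-stable zero    m f f≈0 = refl
  sum-stable (suc k) m f f≈0 =
    trans (+-cong (sum-stable k m f f≈0) (f≈0 (k ℕ.+ m) (ℕ.m≤n+m m k))) (+-identityʳ _)

  prod-cong : ∀ n {f g} → (∀ i → f i ≈ g i) → prod n f ≈ prod n g
  prod-cong zero    f≈g = refl
  prod-cong (suc n) f≈g = *-cong (prod-cong n f≈g) (f≈g n)

  prod-* : ∀ n f g → prod n (λ i → f i * g i) ≈ prod n f * prod n g
  prod-* zero    f g = sym (*-identityˡ 1#)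
  prod-* (suc n) f g = trans (*-congʳ (prod-* n f g))
    (solve 4 (λ a b c d → (a :* b) :* (c :* d) := (a :* c) :* (b :* d)) refl _ _ _ _)

  prod-+ : ∀ m n f → prod (m ℕ.+ n) f ≈ prod n f * prod m (λ i → f (i ℕ.+ n))
  prod-+ zero    n f = sym (*-identityʳ _)
  prod-+ (suc m) n f = trans (*-congʳ (prod-+ m n f)) (*-assoc _ _ _)

  prod-one : ∀ n → prod n (λ _ → 1#) ≈ 1#
  prod-one zero    = refl
  prod-one (suc n) = trans (*-identityʳ _) (prod-one n)

  prod-swap : ∀ m n (f : ℕ → ℕ → Carrier) →
              prod m (λ i → prod n (f i)) ≈ prod n (λ j → prod m (λ i → f i j))
  prod-swap m zero    f = prod-one m
  prod-swap m (suc n) f = trans (prod-* m _ _) (*-congʳ (prod-swap m n f))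

  prod-stable : ∀ k m f → (∀ i → m ≤ i → f i ≈ 1#) → prod (k ℕ.+ m) f ≈ prod m f
  prod-stable zero    m f f≈1 = refl
  prod-stable (suc k) m f f≈1 =
    trans (*-cong (prod-stable k m f f≈1) (f≈1 (k ℕ.+ m) (ℕ.m≤n+m m k))) (*-identityʳ _)

  prod-blocks : ∀ m n f → prod (m ℕ.* n) f ≈ prod m (λ i → prod n (λ j → f (j ℕ.+ i ℕ.* n)))
  prod-blocks zero    n f = refl
  prod-blocks (suc m) n f = trans (prod-+ n (m ℕ.* n) f) (*-congʳ (prod-blocks m n f))

  Invertible : Carrier → Set _
  Invertible x = Σ Carrier λ y → y * x ≈ 1#

  invertible-* : ∀ {x y} → Invertible x → Invertible y → Invertible (x * y)
  invertible-* {x} {y} (x′ , x′x≈1) (y′ , y′y≈1) = x′ * y′ , (begin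
    (x′ * y′) * (x * y)  ≈⟨ solve 4 (λ a b c d → (a :* b) :* (c :* d) := (a :* c) :* (b :* d)) refl _ _ _ _ ⟩
    (x′ * x) * (y′ * y)  ≈⟨ *-cong x′x≈1 y′y≈1 ⟩
    1# * 1#              ≈⟨ *-identityˡ 1# ⟩
    1#                   ∎)

  invertible-prod : ∀ n f → (∀ i → Invertible (f i)) → Invertible (prod n f)
  invertible-prod zero    f inv = 1# , *-identityˡ 1#
  invertible-prod (suc n) f inv = invertible-* (invertible-prod n f inv) (inv n)

  -- The recursion for `g` is one unfolding of a geometric series. `x` and `y` are kept apart
  -- because the recursion will be known for the monomial of degree e, while the factor to invert is
  -- written with the e-th power of q.
  geometric-inverse : ∀ {x y g} → y ≈ x → g ≈ 1# + x * g → g * (1# - y) ≈ 1#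
  geometric-inverse {x} {y} {g} y≈x g≈1+xg = begin
    g * (1# - y)          ≈⟨ *-congˡ (+-congˡ (-‿cong y≈x)) ⟩
    g * (1# - x)          ≈⟨ solve 2 (λ g x → g :* (con (+ 1) :- x) := g :- x :* g) refl g x ⟩
    g - x * g             ≈⟨ +-congʳ g≈1+xg ⟩
    1# + x * g - x * g    ≈⟨ solve 2 (λ g x → con (+ 1) :+ x :* g :- x :* g := con (+ 1)) refl g x ⟩
    1#                    ∎

  prod-inverse : ∀ n {f g} → (∀ i → g i * f i ≈ 1#) → prod n g * prod n f ≈ 1#
  prod-inverse n gf≈1 = trans (sym (prod-* n _ _)) (trans (prod-cong n gf≈1) (prod-one n))

  cancelˡ : ∀ {x a b} → Invertible x → x * a ≈ x * b → a ≈ b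
  cancelˡ {x} {a} {b} (y , yx≈1) xa≈xb = begin
    a            ≈⟨ *-identityˡ a ⟨
    1# * a       ≈⟨ *-congʳ yx≈1 ⟨
    (y * x) * a  ≈⟨ *-assoc y x a ⟩
    y * (x * a)  ≈⟨ *-congˡ xa≈xb ⟩
    y * (x * b)  ≈⟨ *-assoc y x b ⟨
    (y * x) * b  ≈⟨ *-congʳ yx≈1 ⟩
    1# * b       ≈⟨ *-identityˡ b ⟩
    b            ∎

-- Gaussian binomial coefficients

module Gaussian {c ℓ} (R : CommutativeRing c ℓ) (p : CommutativeRing.Carrier R) where
  open CommutativeRing R hiding (zero)
  open IntegerCoefficients R using (solve; _:+_; _:*_; _:-_; _:=_; con)
  open import Algebra.Properties.Semiring.Exp semiring
  open import Relation.Binary.Reasoning.Setoid setoid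
  open Sums R

  -- Defined by one of the two Pascal rules; the other one is `gauss-pascal`. The truncated exponent
  -- `n ∸ l` is harmless, as the coefficient it multiplies vanishes for l > n.
  gauss : ℕ → ℕ → Carrier
  gauss n       zero    = 1#
  gauss zero    (suc l) = 0#
  gauss (suc n) (suc l) = p ^ (n ∸ l) * gauss n l + gauss n (suc l)

  gauss-zero : ∀ n l → n < l → gauss n l ≈ 0#
  gauss-zero zero    (suc l) n<l = refl
  gauss-zero (suc n) (suc l) (s≤s n<l) = begin
    p ^ (n ∸ l) * gauss n l + gauss n (suc l)
      ≈⟨ +-cong (*-congˡ (gauss-zero n l n<l)) (gauss-zero n (suc l) (ℕ.m≤n⇒m≤1+n n<l)) ⟩
    p ^ (n ∸ l) * 0# + 0#
      ≈⟨ trans (+-identityʳ _) (zeroʳ _) ⟩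
    0# ∎

  ^-split : ∀ {k n} → k ≤ n → p ^ k * p ^ (n ∸ k) ≈ p ^ n
  ^-split {k} {n} k≤n = trans (sym (^-homo-* p k (n ∸ k))) (^-congʳ p (ℕ.m+[n∸m]≡n k≤n))

  -- Both powers are p^(n+1) as long as l < n. For l ≥ n truncated subtraction spoils this, but then
  -- the Gaussian coefficient is zero.
  gauss-shift : ∀ n l → p ^ suc (suc l) * p ^ (n ∸ suc l) * gauss n (suc l)
                      ≈ p ^ suc l * p ^ (n ∸ l) * gauss n (suc l)
  gauss-shift n l with ℕ.<-≤-connex l n
  ... | inj₁ l<n = *-congʳ (trans (*-assoc _ _ _) (trans (*-congˡ (^-split l<n))
                   (sym (trans (*-assoc _ _ _) (*-congˡ (^-split (ℕ.<⇒≤ l<n)))))))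
  ... | inj₂ n≤l = trans (trans (*-congˡ g≈0) (zeroʳ _)) (sym (trans (*-congˡ g≈0) (zeroʳ _)))
    where g≈0 = gauss-zero n (suc l) (s≤s n≤l)

  -- Induction along the defining Pascal rule gives the ratio of neighbours in a row, with the
  -- denominator cleared; for l ≥ n both sides are zero. The second Pascal rule and the factorial
  -- formula both rest on it.
  absorption : ∀ n l → (1# - p ^ suc l) * gauss n (suc l) ≈ (1# - p ^ (n ∸ l)) * gauss n l
  absorption zero l = begin
    (1# - p ^ suc l) * 0#            ≈⟨ zeroʳ _ ⟩
    0#                               ≈⟨ zeroˡ _ ⟨
    0# * gauss zero l                ≈⟨ *-congʳ (-‿inverseʳ 1#) ⟨
    (1# - 1#) * gauss zero l         ≡⟨ ≡.cong (λ k → (1# - p ^ k) * gauss zero l) (ℕ.0∸n≡0 l) ⟨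
    (1# - p ^ (0 ∸ l)) * gauss zero l ∎
  absorption (suc n) zero = begin
    (1# - p * 1#) * (p ^ n * 1# + gauss n 1)
      ≈⟨ distribˡ _ _ _ ⟩
    (1# - p * 1#) * (p ^ n * 1#) + (1# - p * 1#) * gauss n 1
      ≈⟨ +-congˡ (absorption n 0) ⟩
    (1# - p * 1#) * (p ^ n * 1#) + (1# - p ^ n) * 1#
      ≈⟨ solve 2 (λ x y → (con (+ 1) :- x :* con (+ 1)) :* (y :* con (+ 1)) :+ (con (+ 1) :- y) :* con (+ 1)
                       := (con (+ 1) :- x :* y) :* con (+ 1)) refl p (p ^ n) ⟩
    (1# - p ^ suc n) * 1# ∎
  absorption (suc n) (suc l) = begin
    (1# - P) * (T * g + gauss n (suc (suc l)))
      ≈⟨ distribˡ _ _ _ ⟩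
    (1# - P) * (T * g) + (1# - P) * gauss n (suc (suc l))
      ≈⟨ +-congˡ (absorption n (suc l)) ⟩
    (1# - P) * (T * g) + (1# - T) * g
      ≈⟨ solve 3 (λ P T g → (con (+ 1) :- P) :* (T :* g) :+ (con (+ 1) :- T) :* g
                          := g :- P :* T :* g) refl P T g ⟩
    g - P * T * g
      ≈⟨ +-congˡ (-‿cong (gauss-shift n l)) ⟩
    g - p ^ suc l * U * g
      ≈⟨ solve 3 (λ P U g → g :- P :* U :* g
                          := U :* ((con (+ 1) :- P) :* g) :+ (con (+ 1) :- U) :* g) refl (p ^ suc l) U g ⟩
    U * ((1# - p ^ suc l) * g) + (1# - U) * g
      ≈⟨ +-congʳ (*-congˡ (absorption n l)) ⟩
    U * ((1# - U) * gauss n l) + (1# - U) * g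
      ≈⟨ solve 3 (λ U h g → U :* ((con (+ 1) :- U) :* h) :+ (con (+ 1) :- U) :* g
                          := (con (+ 1) :- U) :* (U :* h :+ g)) refl U (gauss n l) g ⟩
    (1# - U) * (U * gauss n l + g) ∎
    where
    P = p ^ suc (suc l)
    T = p ^ (n ∸ suc l)
    U = p ^ (n ∸ l)
    g = gauss n (suc l)

  -- The right sides of the two Pascal rules differ by the two sides of `absorption`. This form is
  -- the one that produces the `B` factors of the triple product.
  gauss-pascal : ∀ n l → gauss (suc n) (suc l) ≈ gauss n l + p ^ suc l * gauss n (suc l)
  gauss-pascal n l = begin
    U * h + g
      ≈⟨ solve 4 (λ U P h g → U :* h :+ g := U :* h :+ P :* g :+ (con (+ 1) :- P) :* g) refl U (p ^ suc l) h g ⟩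
    U * h + p ^ suc l * g + (1# - p ^ suc l) * g
      ≈⟨ +-congˡ (absorption n l) ⟩
    U * h + p ^ suc l * g + (1# - U) * h
      ≈⟨ solve 4 (λ U P h g → U :* h :+ P :* g :+ (con (+ 1) :- U) :* h := h :+ P :* g) refl U (p ^ suc l) h g ⟩
    h + p ^ suc l * g ∎
    where
    U = p ^ (n ∸ l)
    h = gauss n l
    g = gauss n (suc l)

  factorial : ℕ → Carrier
  factorial n = prod n (λ i → 1# - p ^ suc i)

  -- Each step of the induction trades, by `absorption`, the last factor 1 - p^(l+1) of one
  -- factorial for a new factor 1 - p^(m+1) of the other.
  gauss-factorial : ∀ m l → gauss (m ℕ.+ l) l * factorial l * factorial m ≈ factorial (m ℕ.+ l)
  gauss-factorial m zero = begin
    gauss (m ℕ.+ 0) 0 * 1# * factorial m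
      ≈⟨ trans (*-congʳ (*-identityʳ _)) (*-identityˡ _) ⟩
    factorial m
      ≡⟨ ≡.cong factorial (ℕ.+-identityʳ m) ⟨
    factorial (m ℕ.+ 0) ∎
  gauss-factorial m (suc l) = begin
    gauss (m ℕ.+ suc l) (suc l) * (factorial l * (1# - p ^ suc l)) * factorial m
      ≡⟨ ≡.cong (λ k → gauss k (suc l) * (factorial l * (1# - p ^ suc l)) * factorial m) (ℕ.+-suc m l) ⟩
    gauss (suc m ℕ.+ l) (suc l) * (factorial l * (1# - p ^ suc l)) * factorial m
      ≈⟨ solve 4 (λ g f P e → g :* (f :* P) :* e := (P :* g) :* f :* e) refl _ _ _ _ ⟩
    ((1# - p ^ suc l) * gauss (suc m ℕ.+ l) (suc l)) * factorial l * factorial m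
      ≈⟨ *-congʳ (*-congʳ (absorption (suc m ℕ.+ l) l)) ⟩
    ((1# - p ^ (suc m ℕ.+ l ∸ l)) * gauss (suc m ℕ.+ l) l) * factorial l * factorial m
      ≡⟨ ≡.cong (λ k → ((1# - p ^ k) * gauss (suc m ℕ.+ l) l) * factorial l * factorial m) (ℕ.m+n∸n≡m (suc m) l) ⟩
    ((1# - p ^ suc m) * gauss (suc m ℕ.+ l) l) * factorial l * factorial m
      ≈⟨ solve 4 (λ P g f e → P :* g :* f :* e := g :* f :* (e :* P)) refl _ _ _ _ ⟩
    gauss (suc m ℕ.+ l) l * factorial l * factorial (suc m)
      ≈⟨ gauss-factorial (suc m) l ⟩
    factorial (suc m ℕ.+ l)
      ≡⟨ ≡.cong factorial (ℕ.+-suc m l) ⟨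
    factorial (m ℕ.+ suc l) ∎

-- The finite form of the Jacobi triple product

module FiniteTripleProduct {c ℓ} (R : CommutativeRing c ℓ) (A B p : CommutativeRing.Carrier R)
  (AB≈p : CommutativeRing._≈_ R (CommutativeRing._*_ R A B) p) where
  open CommutativeRing R hiding (zero)
  open IntegerCoefficients R using (solve; _:+_; _:*_; _:-_; :-_; _:=_; con)
  open import Algebra.Properties.Semiring.Exp semiring
  open import Relation.Binary.Reasoning.Setoid setoid
  open Sums R
  open Gaussian R p

  -- (-1)ʲ p^(j(j-1)/2) Xʲ
  coeff : Carrier → ℕ → Carrier
  coeff X zero    = 1#
  coeff X (suc j) = - (X * p ^ j) * coeff X j

  -- shifted n l is the coefficient of index l - n in the bilateral series.
  shifted : ℕ → ℕ → Carrier
  shifted zero    l       = coeff A l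
  shifted (suc n) zero    = coeff B (suc n)
  shifted (suc n) (suc l) = shifted n l

  shifted-left : ∀ n l → l ≤ n → shifted n l ≡ coeff B (n ∸ l)
  shifted-left zero    zero    _         = ≡.refl
  shifted-left (suc n) zero    _         = ≡.refl
  shifted-left (suc n) (suc l) (s≤s l≤n) = shifted-left n l l≤n

  shifted-right : ∀ n i → shifted n (n ℕ.+ i) ≡ coeff A i
  shifted-right zero    i = ≡.refl
  shifted-right (suc n) i = shifted-right n i

  sum-shifted : ∀ n m → sum (n ℕ.+ m) (shifted n) ≈ sum n (λ j → coeff B (suc j)) + sum m (coeff A)
  sum-shifted zero    m = sym (+-identityˡ _)
  sum-shifted (suc n) m = begin
    sum (suc n ℕ.+ m) (shifted (suc n))
      ≈⟨ sum-front (n ℕ.+ m) (shifted (suc n)) ⟩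
    coeff B (suc n) + sum (n ℕ.+ m) (shifted n)
      ≈⟨ +-congˡ (sum-shifted n m) ⟩
    coeff B (suc n) + (sum n (λ j → coeff B (suc j)) + sum m (coeff A))
      ≈⟨ solve 3 (λ x y z → x :+ (y :+ z) := (y :+ x) :+ z) refl _ _ _ ⟩
    sum (suc n) (λ j → coeff B (suc j)) + sum m (coeff A) ∎

  -- Consecutive coefficients have ratio -A p^(l-n), and the weight p^(N-l) from the defining Pascal
  -- rule cancels the dependence on l. For l < n this ratio would be a negative power of p times A;
  -- there `A * B ≈ p` does the work.
  shifted-stepA : ∀ N n l → n ≤ N → l ≤ N →
                  shifted n (suc l) * p ^ (N ∸ l) ≈ - (A * p ^ (N ∸ n)) * shifted n l
  shifted-stepA N zero l _ l≤N = begin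
    - (A * p ^ l) * coeff A l * p ^ (N ∸ l)
      ≈⟨ solve 4 (λ A P c Q → :- (A :* P) :* c :* Q := :- (A :* (P :* Q)) :* c) refl A (p ^ l) (coeff A l) (p ^ (N ∸ l)) ⟩
    - (A * (p ^ l * p ^ (N ∸ l))) * coeff A l
      ≈⟨ *-congʳ (-‿cong (*-congˡ (^-split l≤N))) ⟩
    - (A * p ^ N) * coeff A l ∎
  shifted-stepA (suc N) (suc n) zero (s≤s n≤N) _ = begin
    shifted n 0 * (p * p ^ N)
      ≡⟨ ≡.cong (_* (p * p ^ N)) (shifted-left n 0 z≤n) ⟩
    coeff B n * (p * p ^ N)
      ≈⟨ *-congˡ (*-cong AB≈p (^-split n≤N)) ⟨
    coeff B n * ((A * B) * (p ^ n * p ^ (N ∸ n)))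
      ≈⟨ solve 5 (λ c A B P Q → c :* ((A :* B) :* (P :* Q)) := :- (A :* Q) :* (:- (B :* P) :* c)) refl (coeff B n) A B (p ^ n) (p ^ (N ∸ n)) ⟩
    - (A * p ^ (N ∸ n)) * (- (B * p ^ n) * coeff B n) ∎
  shifted-stepA (suc N) (suc n) (suc l) (s≤s n≤N) (s≤s l≤N) = shifted-stepA N n l n≤N l≤N

  -- Lowering the bilateral index l - n by one multiplies the coefficient by -B p^(n-l); the weight
  -- p^l from `gauss-pascal` makes the factor independent of l.
  shifted-stepB : ∀ n l → l ≤ n → shifted (suc n) l * p ^ l ≈ - (B * p ^ n) * shifted n l
  shifted-stepB n l l≤n = begin
    shifted (suc n) l * p ^ l
      ≡⟨ ≡.cong (_* p ^ l) (≡.trans (shifted-left (suc n) l (ℕ.m≤n⇒m≤1+n l≤n)) (≡.cong (coeff B) (ℕ.+-∸-assoc 1 l≤n))) ⟩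
    - (B * p ^ (n ∸ l)) * coeff B (n ∸ l) * p ^ l
      ≈⟨ solve 4 (λ B P c Q → :- (B :* P) :* c :* Q := :- (B :* (Q :* P)) :* c) refl B (p ^ (n ∸ l)) (coeff B (n ∸ l)) (p ^ l) ⟩
    - (B * (p ^ l * p ^ (n ∸ l))) * coeff B (n ∸ l)
      ≈⟨ *-cong (-‿cong (*-congˡ (^-split l≤n))) (reflexive (≡.sym (shifted-left n l l≤n))) ⟩
    - (B * p ^ n) * shifted n l ∎

  -- The series side of the finite identity: `n` counts the factors with `B`, and `N` all factors.
  weighted : ℕ → ℕ → Carrier
  weighted n N = sum (suc N) (λ l → shifted n l * gauss N l)

  sum-gauss-last : ∀ N (f : ℕ → Carrier) → sum (suc (suc N)) (λ l → f l * gauss N l) ≈ sum (suc N) (λ l → f l * gauss N l)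
  sum-gauss-last N f = sum-stable 1 (suc N) _ λ i N<i → trans (*-congˡ (gauss-zero N i N<i)) (zeroʳ _)

  -- Of the two summands of the Pascal rule, one yields -A p^(N-n) times the old sum, and the other,
  -- together with the term l = 0, the old sum itself.
  weighted-stepA : ∀ n N → n ≤ N → weighted n (suc N) ≈ weighted n N * (1# - A * p ^ (N ∸ n))
  weighted-stepA n N n≤N = begin
    weighted n (suc N)
      ≈⟨ sum-front (suc N) _ ⟩
    shifted n 0 * 1# + sum (suc N) (λ l → shifted n (suc l) * (p ^ (N ∸ l) * gauss N l + gauss N (suc l)))
      ≈⟨ +-congˡ (sum-cong (suc N) λ l l≤N → trans
           (solve 4 (λ d P g h → d :* (P :* g :+ h) := (d :* P) :* g :+ d :* h) refl _ _ _ _)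
           (+-congʳ (trans (*-congʳ (shifted-stepA N n l n≤N (ℕ.s≤s⁻¹ l≤N))) (*-assoc _ _ _)))) ⟩
    shifted n 0 * 1# + sum (suc N) (λ l → X * (shifted n l * gauss N l) + shifted n (suc l) * gauss N (suc l))
      ≈⟨ +-congˡ (trans (sum-+ (suc N) _ _) (+-congʳ (sum-*ˡ (suc N) X _))) ⟩
    shifted n 0 * 1# + (X * weighted n N + sum (suc N) (λ l → shifted n (suc l) * gauss N (suc l)))
      ≈⟨ solve 3 (λ a b c → a :+ (b :+ c) := b :+ (a :+ c)) refl _ _ _ ⟩
    X * weighted n N + (shifted n 0 * 1# + sum (suc N) (λ l → shifted n (suc l) * gauss N (suc l)))
      ≈⟨ +-congˡ (sum-front (suc N) (λ l → shifted n l * gauss N l)) ⟨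
    X * weighted n N + sum (suc (suc N)) (λ l → shifted n l * gauss N l)
      ≈⟨ +-congˡ (sum-gauss-last N (shifted n)) ⟩
    X * weighted n N + weighted n N
      ≈⟨ solve 2 (λ Y w → :- Y :* w :+ w := w :* (con (+ 1) :- Y)) refl (A * p ^ (N ∸ n)) (weighted n N) ⟩
    weighted n N * (1# - A * p ^ (N ∸ n)) ∎
    where X = - (A * p ^ (N ∸ n))

  weighted-stepB : ∀ n → weighted (suc n) (suc n) ≈ weighted n n * (1# - B * p ^ n)
  weighted-stepB n = begin
    weighted (suc n) (suc n)
      ≈⟨ sum-front (suc n) _ ⟩
    d 0 * 1# + sum (suc n) (λ l → shifted n l * gauss (suc n) (suc l))
      ≈⟨ +-congˡ (sum-cong (suc n) λ l _ → trans (*-congˡ (gauss-pascal n l))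
           (solve 4 (λ d g P h → d :* (g :+ P :* h) := d :* g :+ d :* P :* h) refl _ _ _ _)) ⟩
    d 0 * 1# + sum (suc n) (λ l → shifted n l * gauss n l + d (suc l) * p ^ suc l * gauss n (suc l))
      ≈⟨ +-congˡ (sum-+ (suc n) _ _) ⟩
    d 0 * 1# + (weighted n n + sum (suc n) (λ l → d (suc l) * p ^ suc l * gauss n (suc l)))
      ≈⟨ solve 3 (λ a b c → a :* con (+ 1) :+ (b :+ c) := b :+ (a :* con (+ 1) :* con (+ 1) :+ c)) refl _ _ _ ⟩
    weighted n n + (d 0 * 1# * 1# + sum (suc n) (λ l → d (suc l) * p ^ suc l * gauss n (suc l)))
      ≈⟨ +-congˡ (sum-front (suc n) (λ l → d l * p ^ l * gauss n l)) ⟨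
    weighted n n + sum (suc (suc n)) (λ l → d l * p ^ l * gauss n l)
      ≈⟨ +-congˡ (sum-gauss-last n (λ l → d l * p ^ l)) ⟩
    weighted n n + sum (suc n) (λ l → d l * p ^ l * gauss n l)
      ≈⟨ +-congˡ (sum-cong (suc n) λ l l≤n → trans (*-congʳ (shifted-stepB n l (ℕ.s≤s⁻¹ l≤n))) (*-assoc _ _ _)) ⟩
    weighted n n + sum (suc n) (λ l → - (B * p ^ n) * (shifted n l * gauss n l))
      ≈⟨ +-congˡ (sum-*ˡ (suc n) _ _) ⟩
    weighted n n + - (B * p ^ n) * weighted n n
      ≈⟨ solve 2 (λ Y w → w :+ :- Y :* w := w :* (con (+ 1) :- Y)) refl (B * p ^ n) (weighted n n) ⟩
    weighted n n * (1# - B * p ^ n) ∎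
    where d = shifted (suc n)

  -- All `B` factors are inserted first, while there is no `A` factor, because `weighted-stepB`
  -- works on the diagonal; the `A` factors follow one by one.
  finite-triple-product : ∀ m n → weighted n (m ℕ.+ n)
    ≈ prod n (λ i → 1# - B * p ^ i) * prod m (λ i → 1# - A * p ^ i)
  finite-triple-product zero zero = solve 0 (con (+ 0) :+ con (+ 1) :* con (+ 1) := con (+ 1) :* con (+ 1)) refl
  finite-triple-product zero (suc n) = begin
    weighted (suc n) (suc n)
      ≈⟨ weighted-stepB n ⟩
    weighted n n * (1# - B * p ^ n)
      ≈⟨ *-congʳ (trans (finite-triple-product zero n) (*-identityʳ _)) ⟩
    prod (suc n) (λ i → 1# - B * p ^ i)
      ≈⟨ *-identityʳ _ ⟨
    prod (suc n) (λ i → 1# - B * p ^ i) * 1# ∎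
  finite-triple-product (suc m) n = begin
    weighted n (suc (m ℕ.+ n))
      ≈⟨ weighted-stepA n (m ℕ.+ n) (ℕ.m≤n+m n m) ⟩
    weighted n (m ℕ.+ n) * (1# - A * p ^ (m ℕ.+ n ∸ n))
      ≡⟨ ≡.cong (λ k → weighted n (m ℕ.+ n) * (1# - A * p ^ k)) (ℕ.m+n∸n≡m m n) ⟩
    weighted n (m ℕ.+ n) * (1# - A * p ^ m)
      ≈⟨ *-congʳ (finite-triple-product m n) ⟩
    prod n (λ i → 1# - B * p ^ i) * prod m (λ i → 1# - A * p ^ i) * (1# - A * p ^ m)
      ≈⟨ *-assoc _ _ _ ⟩
    prod n (λ i → 1# - B * p ^ i) * prod (suc m) (λ i → 1# - A * p ^ i) ∎

-- Sums over windows of integers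

module BilateralSums {c ℓ} (R : CommutativeRing c ℓ) where
  open CommutativeRing R hiding (zero)
  open IntegerCoefficients R using (solve; _:+_; _:*_; _:=_)
  open import Relation.Binary.Reasoning.Setoid setoid
  open Sums R

  -- Σ f(z) over -M ≤ z < M
  ∑± : ℕ → (ℤ → Carrier) → Carrier
  ∑± zero    f = 0#
  ∑± (suc M) f = ∑± M f + (f (+ M) + f -[1+ M ])

  ∑±-as-sum : ∀ M f → ∑± M f ≡ sum M (λ i → f (+ i) + f -[1+ i ])
  ∑±-as-sum zero    f = ≡.refl
  ∑±-as-sum (suc M) f = ≡.cong (_+ (f (+ M) + f -[1+ M ])) (∑±-as-sum M f)

  ∑±-cong : ∀ M {f g} → (∀ z → ∣ z ∣ ≤ M → f z ≈ g z) → ∑± M f ≈ ∑± M g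
  ∑±-cong zero    f≈g = refl
  ∑±-cong (suc M) f≈g = +-cong (∑±-cong M λ z z≤M → f≈g z (ℕ.m≤n⇒m≤1+n z≤M))
    (+-cong (f≈g (+ M) (ℕ.n≤1+n M)) (f≈g -[1+ M ] ℕ.≤-refl))

  ∑±-zero : ∀ M → ∑± M (λ _ → 0#) ≈ 0#
  ∑±-zero zero    = refl
  ∑±-zero (suc M) = trans (+-cong (∑±-zero M) (+-identityʳ 0#)) (+-identityʳ 0#)

  ∑±-+ : ∀ M f g → ∑± M (λ z → f z + g z) ≈ ∑± M f + ∑± M g
  ∑±-+ zero    f g = sym (+-identityʳ 0#)
  ∑±-+ (suc M) f g = trans (+-congʳ (∑±-+ M f g))
    (solve 6 (λ s t a b c d → (s :+ t) :+ ((a :+ b) :+ (c :+ d)) := (s :+ (a :+ c)) :+ (t :+ (b :+ d)))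
      refl _ _ _ _ _ _)

  ∑±-*ˡ : ∀ M a f → ∑± M (λ z → a * f z) ≈ a * ∑± M f
  ∑±-*ˡ zero    a f = sym (zeroʳ a)
  ∑±-*ˡ (suc M) a f = trans (+-congʳ (∑±-*ˡ M a f))
    (solve 4 (λ a s b c → a :* s :+ (a :* b :+ a :* c) := a :* (s :+ (b :+ c))) refl _ _ _ _)

  ∑±-*ʳ : ∀ M a f → ∑± M (λ z → f z * a) ≈ ∑± M f * a
  ∑±-*ʳ M a f = trans (∑±-cong M λ z _ → *-comm _ _) (trans (∑±-*ˡ M a f) (*-comm _ _))

  ∑±-* : ∀ M K f g → ∑± M (λ m → ∑± K (λ n → f m * g n)) ≈ ∑± M f * ∑± K g
  ∑±-* M K f g = trans (∑±-cong M λ m _ → ∑±-*ˡ K (f m) g) (∑±-*ʳ M (∑± K g) f)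

  ∑±-swap : ∀ M K (f : ℤ → ℤ → Carrier) →
            ∑± M (λ m → ∑± K (f m)) ≈ ∑± K (λ n → ∑± M (λ m → f m n))
  ∑±-swap zero    K f = sym (∑±-zero K)
  ∑±-swap (suc M) K f = begin
    ∑± M (λ m → ∑± K (f m)) + (∑± K (f (+ M)) + ∑± K (f -[1+ M ]))
      ≈⟨ +-cong (∑±-swap M K f) (sym (∑±-+ K _ _)) ⟩
    ∑± K (λ n → ∑± M (λ m → f m n)) + ∑± K (λ n → f (+ M) n + f -[1+ M ] n)
      ≈⟨ ∑±-+ K _ _ ⟨
    ∑± K (λ n → ∑± (suc M) (λ m → f m n)) ∎

  Vanishes : ℕ → (ℤ → Carrier) → Set _
  Vanishes K f = ∀ z → K ≤ ∣ z ∣ → f z ≈ 0#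

  ∑±-stable : ∀ {K f M} → Vanishes K f → K ≤ M → ∑± M f ≈ ∑± K f
  ∑±-stable {K} {f} {M} f≈0 K≤M = trans (reflexive (≡.cong (λ k → ∑± k f) (≡.sym (ℕ.m∸n+n≡m K≤M)))) (go (M ∸ K))
    where
    go : ∀ k → ∑± (k ℕ.+ K) f ≈ ∑± K f
    go zero    = refl
    go (suc k) = trans (+-cong (go k) (trans (+-cong (f≈0 (+ (k ℕ.+ K)) (ℕ.m≤n+m K k))
      (f≈0 -[1+ k ℕ.+ K ] (ℕ.m≤n+m K (suc k)))) (+-identityʳ 0#))) (+-identityʳ _)

  -- Both sides are the sum of `f` over the closed window -M ≤ z ≤ M.
  ∑±-suc : ∀ M f → ∑± M (λ z → f (ℤ.suc z)) + f (ℤ.- + M) ≈ ∑± M f + f (+ M)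
  ∑±-suc zero    f = refl
  ∑±-suc (suc M) f = begin
    ∑± M (λ z → f (ℤ.suc z)) + (f (+ suc M) + f (ℤ.suc -[1+ M ])) + f -[1+ M ]
      ≡⟨ ≡.cong (λ z → ∑± M (λ z → f (ℤ.suc z)) + (f (+ suc M) + f z) + f -[1+ M ]) (ℤ.[1+m]⊖[1+n]≡m⊖n 0 M) ⟩
    ∑± M (λ z → f (ℤ.suc z)) + (f (+ suc M) + f (0 ℤ.⊖ M)) + f -[1+ M ]
      ≡⟨ ≡.cong (λ z → ∑± M (λ z → f (ℤ.suc z)) + (f (+ suc M) + f z) + f -[1+ M ]) (0⊖ M) ⟩
    ∑± M (λ z → f (ℤ.suc z)) + (f (+ suc M) + f (ℤ.- + M)) + f -[1+ M ]
      ≈⟨ solve 4 (λ s a b c → s :+ (a :+ b) :+ c := (s :+ b) :+ (a :+ c)) refl _ _ _ _ ⟩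
    (∑± M (λ z → f (ℤ.suc z)) + f (ℤ.- + M)) + (f (+ suc M) + f -[1+ M ])
      ≈⟨ +-congʳ (∑±-suc M f) ⟩
    (∑± M f + f (+ M)) + (f (+ suc M) + f -[1+ M ])
      ≈⟨ solve 4 (λ s a b c → (s :+ a) :+ (b :+ c) := s :+ (a :+ c) :+ b) refl _ _ _ _ ⟩
    ∑± M f + (f (+ M) + f -[1+ M ]) + f (+ suc M) ∎
    where
    0⊖ : ∀ m → 0 ℤ.⊖ m ≡ ℤ.- + m
    0⊖ zero    = ≡.refl
    0⊖ (suc m) = ≡.refl

  ∑±-translate₁ : ∀ {K M f} → Vanishes K f → K ≤ M → ∑± M (λ z → f (ℤ.suc z)) ≈ ∑± M f
  ∑±-translate₁ {K} {M} {f} f≈0 K≤M = begin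
    ∑± M (λ z → f (ℤ.suc z))                   ≈⟨ +-identityʳ _ ⟨
    ∑± M (λ z → f (ℤ.suc z)) + 0#              ≈⟨ +-congˡ (f≈0 (ℤ.- + M) (≡.subst (K ≤_) (≡.sym (ℤ.∣-i∣≡∣i∣ (+ M))) K≤M)) ⟨
    ∑± M (λ z → f (ℤ.suc z)) + f (ℤ.- + M)     ≈⟨ ∑±-suc M f ⟩
    ∑± M f + f (+ M)                           ≈⟨ +-congˡ (f≈0 (+ M) K≤M) ⟩
    ∑± M f + 0#                                ≈⟨ +-identityʳ _ ⟩
    ∑± M f                                     ∎

  vanishes-translate : ∀ {K f} t → Vanishes K f → Vanishes (K ℕ.+ ∣ t ∣) (λ z → f (z ℤ.+ t))
  vanishes-translate {K} {f} t f≈0 z K+t≤z = f≈0 (z ℤ.+ t) (ℕ.+-cancelʳ-≤ (∣ t ∣) K _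
    (ℕ.≤-trans K+t≤z (ℕ.≤-trans (ℕ.≤-reflexive (≡.cong ∣_∣ z≡)) (ℤ.∣i-j∣≤∣i∣+∣j∣ (z ℤ.+ t) t))))
    where
    z≡ : z ≡ (z ℤ.+ t) ℤ.- t
    z≡ = ≡.sym (≡.trans (ℤ.+-assoc z t (ℤ.- t)) (≡.trans (≡.cong (λ u → z ℤ.+ u) (ℤ.+-inverseʳ t)) (ℤ.+-identityʳ z)))

  -- Iterated unit translations. Each may move the support outward by one, hence the margin `∣ t ∣`
  -- in the window.
  ∑±-translate : ∀ {K M f} t → Vanishes K f → K ℕ.+ ∣ t ∣ ≤ M → ∑± M (λ z → f (z ℤ.+ t)) ≈ ∑± M f
  ∑±-translate {K} {M} {f} (+ zero) f≈0 K≤M =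
    ∑±-cong M λ z _ → reflexive (≡.cong f (ℤ.+-identityʳ z))
  ∑±-translate {K} {M} {f} (+ suc t) f≈0 K≤M = begin
    ∑± M (λ z → f (z ℤ.+ + suc t))
      ≈⟨ ∑±-cong M (λ z _ → reflexive (≡.cong f (shift z))) ⟩
    ∑± M (λ z → f (ℤ.suc z ℤ.+ + t))
      ≈⟨ ∑±-translate₁ (vanishes-translate {f = f} (+ t) f≈0) K+t≤M ⟩
    ∑± M (λ z → f (z ℤ.+ + t))
      ≈⟨ ∑±-translate (+ t) f≈0 K+t≤M ⟩
    ∑± M f ∎
    where
    K+t≤M = ℕ.≤-trans (ℕ.+-monoʳ-≤ K (ℕ.n≤1+n t)) K≤M
    shift : ∀ z → z ℤ.+ + suc t ≡ ℤ.suc z ℤ.+ + t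
    shift z = ≡.trans (≡.sym (ℤ.+-assoc z (+ 1) (+ t))) (≡.cong (ℤ._+ + t) (ℤ.+-comm z (+ 1)))
  ∑±-translate {K} {M} {f} -[1+ t ] f≈0 K≤M = begin
    ∑± M (λ z → f (z ℤ.+ -[1+ t ]))
      ≈⟨ ∑±-translate₁ (vanishes-translate {f = f} -[1+ t ] f≈0) K≤M ⟨
    ∑± M (λ z → f (ℤ.suc z ℤ.+ -[1+ t ]))
      ≈⟨ ∑±-cong M (λ z _ → reflexive (≡.cong f (shift z))) ⟩
    ∑± M (λ z → f (z ℤ.+ ℤ.- + t))
      ≈⟨ ih t K+t≤M ⟩
    ∑± M f ∎
    where
    K+t≤M = ℕ.≤-trans (ℕ.+-monoʳ-≤ K (ℕ.n≤1+n t)) K≤M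
    -- `ℤ.- + t` reduces to a constructor form only after splitting on `t`, and the recursion has to
    -- go through that split.
    ih : ∀ t → K ℕ.+ t ≤ M → ∑± M (λ z → f (z ℤ.+ ℤ.- + t)) ≈ ∑± M f
    ih zero    _   = ∑±-cong M λ z _ → reflexive (≡.cong f (ℤ.+-identityʳ z))
    ih (suc t) K≤M = ∑±-translate -[1+ t ] f≈0 K≤M
    shift : ∀ z → ℤ.suc z ℤ.+ -[1+ t ] ≡ z ℤ.+ ℤ.- + t
    shift z = solveℤ 2 (λ z t → (conℤ (+ 1) :+ℤ z) :+ℤ (:-ℤ (conℤ (+ 1) :+ℤ t)) :=ℤ z :+ℤ (:-ℤ t)) ≡.refl z (+ t)
      where open ℤ.+-*-Solver using () renaming (solve to solveℤ; _:+_ to _:+ℤ_; :-_ to :-ℤ_; _:=_ to _:=ℤ_; con to conℤ)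

  -- The reason for half-open windows: -2M ≤ s < 2M consists exactly of the numbers 2z and 1 + 2z
  -- with -M ≤ z < M.
  ∑±-parity : ∀ M f → ∑± (M ℕ.+ M) f ≈ ∑± M (λ z → f (z ℤ.+ z)) + ∑± M (λ z → f (+ 1 ℤ.+ (z ℤ.+ z)))
  ∑±-parity zero    f = sym (+-identityʳ 0#)
  ∑±-parity (suc M) f rewrite ℕ.+-suc M M = trans (+-congʳ (+-congʳ (∑±-parity M f)))
    (solve 6 (λ s t a b c d → s :+ t :+ (a :+ b) :+ (c :+ d) := (s :+ (a :+ d)) :+ (t :+ (c :+ b)))
      refl _ _ _ _ _ _)

  -- The pairs (m, n) with m + n = 2a are (b + a, a - b), those with m + n = 2a + 1 are (b + a, 1 + (a - b)).
  ∑±-product : ∀ {N f g} → Vanishes N f → Vanishes N g →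
    ∑± N f * ∑± N g ≈ ∑± N (λ a → ∑± (N ℕ.+ N) (λ b → f (b ℤ.+ a) * g (a ℤ.- b)))
                    + ∑± N (λ a → ∑± (N ℕ.+ N) (λ b → f (b ℤ.+ a) * g (+ 1 ℤ.+ (a ℤ.- b))))
  ∑±-product {N} {f} {g} f≈0 g≈0 = begin
    ∑± N f * ∑± N g
      -- Doubling the window of `g` leaves room for translations by -m with ∣ m ∣ ≤ N, and gives s =
      -- m + n a window that splits by parity.
      ≈⟨ *-congˡ (∑±-stable g≈0 (ℕ.m≤m+n N N)) ⟨
    ∑± N f * ∑± (N ℕ.+ N) g
      ≈⟨ ∑±-*ʳ N _ f ⟨
    ∑± N (λ m → f m * ∑± (N ℕ.+ N) g)
      ≈⟨ ∑±-cong N (λ m m≤N → trans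
           (*-congˡ (sym (∑±-translate (ℤ.- m) g≈0 (ℕ.+-monoʳ-≤ N (≡.subst (_≤ N) (≡.sym (ℤ.∣-i∣≡∣i∣ m)) m≤N)))))
           (sym (∑±-*ˡ (N ℕ.+ N) (f m) _))) ⟩
    ∑± N (λ m → ∑± (N ℕ.+ N) (λ s → f m * g (s ℤ.- m)))
      ≈⟨ ∑±-swap N (N ℕ.+ N) _ ⟩
    ∑± (N ℕ.+ N) (λ s → ∑± N (λ m → f m * g (s ℤ.- m)))
      ≈⟨ ∑±-parity N _ ⟩
    ∑± N (λ a → ∑± N (λ m → f m * g ((a ℤ.+ a) ℤ.- m)))
      + ∑± N (λ a → ∑± N (λ m → f m * g (+ 1 ℤ.+ (a ℤ.+ a) ℤ.- m)))
      ≈⟨ +-cong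
          (∑±-cong N λ a a≤N → recentre a a≤N (a ℤ.+ a) (λ b → a ℤ.- b)
            λ b → solveℤ 2 (λ a b → (a :+ℤ a) :+ℤ (:-ℤ (b :+ℤ a)) :=ℤ a :+ℤ (:-ℤ b)) ≡.refl a b)
          (∑±-cong N λ a a≤N → recentre a a≤N (+ 1 ℤ.+ (a ℤ.+ a)) (λ b → + 1 ℤ.+ (a ℤ.- b))
            λ b → solveℤ 2 (λ a b → (conℤ (+ 1) :+ℤ (a :+ℤ a)) :+ℤ (:-ℤ (b :+ℤ a)) :=ℤ conℤ (+ 1) :+ℤ (a :+ℤ (:-ℤ b))) ≡.refl a b) ⟩
    ∑± N (λ a → ∑± (N ℕ.+ N) (λ b → f (b ℤ.+ a) * g (a ℤ.- b)))
      + ∑± N (λ a → ∑± (N ℕ.+ N) (λ b → f (b ℤ.+ a) * g (+ 1 ℤ.+ (a ℤ.- b)))) ∎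
    where
    open ℤ.+-*-Solver using () renaming (solve to solveℤ; _:+_ to _:+ℤ_; :-_ to :-ℤ_; _:=_ to _:=ℤ_; con to conℤ)
    recentre : ∀ a → ∣ a ∣ ≤ N → ∀ s (r : ℤ → ℤ) → (∀ b → s ℤ.- (b ℤ.+ a) ≡ r b) →
      ∑± N (λ m → f m * g (s ℤ.- m)) ≈ ∑± (N ℕ.+ N) (λ b → f (b ℤ.+ a) * g (r b))
    recentre a a≤N s r s≡r = begin
      ∑± N F                                           ≈⟨ ∑±-stable F≈0 (ℕ.m≤m+n N N) ⟨
      ∑± (N ℕ.+ N) F                                   ≈⟨ ∑±-translate a F≈0 (ℕ.+-monoʳ-≤ N a≤N) ⟨
      ∑± (N ℕ.+ N) (λ b → F (b ℤ.+ a))                 ≈⟨ ∑±-cong (N ℕ.+ N) (λ b _ → *-congˡ (reflexive (≡.cong g (s≡r b)))) ⟩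
      ∑± (N ℕ.+ N) (λ b → f (b ℤ.+ a) * g (r b))       ∎
      where
      F : ℤ → Carrier
      F m = f m * g (s ℤ.- m)
      F≈0 : Vanishes N F
      F≈0 m N≤m = trans (*-congʳ (f≈0 m N≤m)) (zeroˡ _)

-- Quadratic exponents of theta series

triangle : ℕ → ℕ
triangle zero    = 0
triangle (suc j) = j ℕ.+ triangle j

triangle-double : ∀ j → triangle j ℕ.+ triangle j ℕ.+ j ≡ j ℕ.* j
triangle-double zero    = ≡.refl
triangle-double (suc j) = ≡.trans
  (solve 2 (λ j t → (j :+ t) :+ (j :+ t) :+ (con 1 :+ j) := con 1 :+ j :+ j :+ (t :+ t :+ j)) ≡.refl j (triangle j))
  (≡.trans (≡.cong (1 ℕ.+ j ℕ.+ j ℕ.+_) (triangle-double j))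
    (solve 1 (λ j → con 1 :+ j :+ j :+ j :* j := (con 1 :+ j) :* (con 1 :+ j)) ≡.refl j))
  where open ℕ.+-*-Solver

-- (a + b) z (z - 1) / 2 + a z
exponent : ℕ → ℕ → ℤ → ℕ
exponent a b (+ j)    = (a ℕ.+ b) ℕ.* triangle j ℕ.+ a ℕ.* j
exponent a b -[1+ j ] = (a ℕ.+ b) ℕ.* triangle (suc j) ℕ.+ b ℕ.* suc j

-- Doubling clears the denominator of z (z - 1) / 2 and unites the two signs of z. Identities
-- between exponents thus become polynomial identities over ℤ, which `halve` brings back to ℕ.
exponent-quadratic : ∀ a b z → + exponent a b z ℤ.+ + exponent a b z
  ≡ (+ a ℤ.+ + b) ℤ.* (z ℤ.* z) ℤ.+ (+ a ℤ.- + b) ℤ.* z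
exponent-quadratic a b = λ { (+ j) → positive j ; -[1+ j ] → negative j }
  where
  open ≡.≡-Reasoning
  open ℤ.+-*-Solver
  triangleℤ : ∀ j → + triangle j ℤ.+ + triangle j ℤ.+ + j ≡ + j ℤ.* + j
  triangleℤ j = ≡.trans (≡.cong +_ (triangle-double j)) (ℤ.pos-* j j)
  expand : ∀ c j → + ((a ℕ.+ b) ℕ.* triangle j ℕ.+ c ℕ.* j) ≡ (+ a ℤ.+ + b) ℤ.* + triangle j ℤ.+ + c ℤ.* + j
  expand c j = ≡.cong₂ ℤ._+_ (ℤ.pos-* (a ℕ.+ b) (triangle j)) (ℤ.pos-* c j)
  positive : ∀ j → + exponent a b (+ j) ℤ.+ + exponent a b (+ j)
    ≡ (+ a ℤ.+ + b) ℤ.* (+ j ℤ.* + j) ℤ.+ (+ a ℤ.- + b) ℤ.* + j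
  positive j = begin
    + exponent a b (+ j) ℤ.+ + exponent a b (+ j)
      ≡⟨ ≡.cong (λ e → e ℤ.+ e) (expand a j) ⟩
    ((+ a ℤ.+ + b) ℤ.* + triangle j ℤ.+ + a ℤ.* + j) ℤ.+ ((+ a ℤ.+ + b) ℤ.* + triangle j ℤ.+ + a ℤ.* + j)
      ≡⟨ solve 4 (λ a b t j → ((a :+ b) :* t :+ a :* j) :+ ((a :+ b) :* t :+ a :* j)
           := (a :+ b) :* (t :+ t :+ j) :+ (a :- b) :* j) ≡.refl (+ a) (+ b) (+ triangle j) (+ j) ⟩
    (+ a ℤ.+ + b) ℤ.* (+ triangle j ℤ.+ + triangle j ℤ.+ + j) ℤ.+ (+ a ℤ.- + b) ℤ.* + j
      ≡⟨ ≡.cong (λ t → (+ a ℤ.+ + b) ℤ.* t ℤ.+ (+ a ℤ.- + b) ℤ.* + j) (triangleℤ j) ⟩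
    (+ a ℤ.+ + b) ℤ.* (+ j ℤ.* + j) ℤ.+ (+ a ℤ.- + b) ℤ.* + j ∎
  negative : ∀ i → + exponent a b -[1+ i ] ℤ.+ + exponent a b -[1+ i ]
    ≡ (+ a ℤ.+ + b) ℤ.* (-[1+ i ] ℤ.* -[1+ i ]) ℤ.+ (+ a ℤ.- + b) ℤ.* -[1+ i ]
  negative i = begin
    + exponent a b -[1+ i ] ℤ.+ + exponent a b -[1+ i ]
      ≡⟨ ≡.cong (λ e → e ℤ.+ e) (expand b j) ⟩
    ((+ a ℤ.+ + b) ℤ.* + triangle j ℤ.+ + b ℤ.* + j) ℤ.+ ((+ a ℤ.+ + b) ℤ.* + triangle j ℤ.+ + b ℤ.* + j)
      ≡⟨ solve 4 (λ a b t j → ((a :+ b) :* t :+ b :* j) :+ ((a :+ b) :* t :+ b :* j)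
           := (a :+ b) :* (t :+ t :+ j) :+ (a :- b) :* (:- j)) ≡.refl (+ a) (+ b) (+ triangle j) (+ j) ⟩
    (+ a ℤ.+ + b) ℤ.* (+ triangle j ℤ.+ + triangle j ℤ.+ + j) ℤ.+ (+ a ℤ.- + b) ℤ.* (ℤ.- + j)
      ≡⟨ ≡.cong (λ t → (+ a ℤ.+ + b) ℤ.* t ℤ.+ (+ a ℤ.- + b) ℤ.* (ℤ.- + j)) (triangleℤ j) ⟩
    (+ a ℤ.+ + b) ℤ.* (+ j ℤ.* + j) ℤ.+ (+ a ℤ.- + b) ℤ.* (ℤ.- + j) ∎
    where j = suc i

-- The linear part alone gives the bound. It is what makes the window of radius N wide enough for
-- every theta series.
exponent-bound : ∀ {a b} → 1 ≤ a → 1 ≤ b → ∀ z → ∣ z ∣ ≤ exponent a b z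
exponent-bound {a} {b} 1≤a 1≤b = λ { (+ j) → bound a j 1≤a ; -[1+ j ] → bound b (suc j) 1≤b }
  where
  bound : ∀ c j → 1 ≤ c → j ≤ (a ℕ.+ b) ℕ.* triangle j ℕ.+ c ℕ.* j
  bound c j 1≤c = ℕ.≤-trans (ℕ.≤-trans (ℕ.≤-reflexive (≡.sym (ℕ.*-identityˡ j))) (ℕ.*-monoˡ-≤ j 1≤c)) (ℕ.m≤n+m _ _)

halve : ∀ {m n : ℕ} → + m ℤ.+ + m ≡ + n ℤ.+ + n → m ≡ n
halve {m} {n} eq = ℕ.*-cancelˡ-≡ m n 2 (≡.trans (two m) (≡.trans (ℤ.+-injective eq) (≡.sym (two n))))
  where
  two : ∀ k → 2 ℕ.* k ≡ k ℕ.+ k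
  two k = ≡.cong (k ℕ.+_) (ℕ.+-identityʳ k)

-- With half-period h = w + y + z and x = y + z, the pairs below are the exponents of the thetas at
-- x + y, x - y (period 2h) and of the even and odd parts at x and y (period 4h).
module _ (w y z : ℕ) where
  private
    sum-exponent : ∀ a b s c d t →
      + (exponent a b s ℕ.+ exponent c d t) ℤ.+ + (exponent a b s ℕ.+ exponent c d t)
      ≡ ((+ a ℤ.+ + b) ℤ.* (s ℤ.* s) ℤ.+ (+ a ℤ.- + b) ℤ.* s)
        ℤ.+ ((+ c ℤ.+ + d) ℤ.* (t ℤ.* t) ℤ.+ (+ c ℤ.- + d) ℤ.* t)
    sum-exponent a b s c d t = ≡.trans
      (solve 2 (λ e f → (e :+ f) :+ (e :+ f) := (e :+ e) :+ (f :+ f)) ≡.refl (+ exponent a b s) (+ exponent c d t))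
      (≡.cong₂ ℤ._+_ (exponent-quadratic a b s) (exponent-quadratic c d t))
      where open ℤ.+-*-Solver

  -- Both forms on the left have leading coefficient h, so the cross terms s t of m = t + s and n =
  -- s - t cancel and the form becomes diagonal with leading coefficients 2h.
  exponent-even : ∀ s t →
    exponent (y ℕ.+ y ℕ.+ z) (w ℕ.+ w ℕ.+ z) (t ℤ.+ s) ℕ.+ exponent z (w ℕ.+ w ℕ.+ (y ℕ.+ y) ℕ.+ z) (s ℤ.- t)
    ≡ exponent (y ℕ.+ y ℕ.+ (z ℕ.+ z)) (w ℕ.+ w ℕ.+ (w ℕ.+ w) ℕ.+ (y ℕ.+ y) ℕ.+ (z ℕ.+ z)) s
      ℕ.+ exponent (w ℕ.+ w ℕ.+ (y ℕ.+ y) ℕ.+ (y ℕ.+ y) ℕ.+ (z ℕ.+ z)) (w ℕ.+ w ℕ.+ (z ℕ.+ z)) t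
  exponent-even s t = halve (≡.trans (sum-exponent _ _ (t ℤ.+ s) _ _ (s ℤ.- t)) (≡.trans
    (solve 5 (λ w y z s t →
       (y :+ y :+ z :+ (w :+ w :+ z)) :* ((t :+ s) :* (t :+ s)) :+ (y :+ y :+ z :- (w :+ w :+ z)) :* (t :+ s)
       :+ ((z :+ (w :+ w :+ (y :+ y) :+ z)) :* ((s :- t) :* (s :- t)) :+ (z :- (w :+ w :+ (y :+ y) :+ z)) :* (s :- t))
       := (y :+ y :+ (z :+ z) :+ (w :+ w :+ (w :+ w) :+ (y :+ y) :+ (z :+ z))) :* (s :* s)
          :+ (y :+ y :+ (z :+ z) :- (w :+ w :+ (w :+ w) :+ (y :+ y) :+ (z :+ z))) :* s
          :+ ((w :+ w :+ (y :+ y) :+ (y :+ y) :+ (z :+ z) :+ (w :+ w :+ (z :+ z))) :* (t :* t)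
          :+ (w :+ w :+ (y :+ y) :+ (y :+ y) :+ (z :+ z) :- (w :+ w :+ (z :+ z))) :* t))
      ≡.refl (+ w) (+ y) (+ z) s t)
    (≡.sym (sum-exponent _ _ s _ _ t))))
    where open ℤ.+-*-Solver

  -- The same change of variables with n = 1 + (s - t); the constant left over is z, the exponent of
  -- x / y.
  exponent-odd : ∀ s t →
    exponent (y ℕ.+ y ℕ.+ z) (w ℕ.+ w ℕ.+ z) (t ℤ.+ s) ℕ.+ exponent z (w ℕ.+ w ℕ.+ (y ℕ.+ y) ℕ.+ z) (+ 1 ℤ.+ (s ℤ.- t))
    ≡ z ℕ.+ (exponent (w ℕ.+ w ℕ.+ (y ℕ.+ y) ℕ.+ (y ℕ.+ y) ℕ.+ (z ℕ.+ z) ℕ.+ (z ℕ.+ z)) (w ℕ.+ w) s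
      ℕ.+ exponent (y ℕ.+ y) (w ℕ.+ w ℕ.+ (w ℕ.+ w) ℕ.+ (y ℕ.+ y) ℕ.+ (z ℕ.+ z) ℕ.+ (z ℕ.+ z)) t)
  exponent-odd s t = halve (≡.trans (sum-exponent _ _ (t ℤ.+ s) _ _ (+ 1 ℤ.+ (s ℤ.- t))) (≡.trans
    (solve 5 (λ w y z s t →
       (y :+ y :+ z :+ (w :+ w :+ z)) :* ((t :+ s) :* (t :+ s)) :+ (y :+ y :+ z :- (w :+ w :+ z)) :* (t :+ s)
       :+ ((z :+ (w :+ w :+ (y :+ y) :+ z)) :* ((con (+ 1) :+ (s :- t)) :* (con (+ 1) :+ (s :- t)))
           :+ (z :- (w :+ w :+ (y :+ y) :+ z)) :* (con (+ 1) :+ (s :- t)))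
       := (z :+ z)
          :+ (((w :+ w :+ (y :+ y) :+ (y :+ y) :+ (z :+ z) :+ (z :+ z)) :+ (w :+ w)) :* (s :* s)
          :+ ((w :+ w :+ (y :+ y) :+ (y :+ y) :+ (z :+ z) :+ (z :+ z)) :- (w :+ w)) :* s
          :+ ((y :+ y :+ (w :+ w :+ (w :+ w) :+ (y :+ y) :+ (z :+ z) :+ (z :+ z))) :* (t :* t)
          :+ (y :+ y :- (w :+ w :+ (w :+ w) :+ (y :+ y) :+ (z :+ z) :+ (z :+ z))) :* t)))
      ≡.refl (+ w) (+ y) (+ z) s t)
    (≡.trans (≡.cong (λ e → (+ z ℤ.+ + z) ℤ.+ e) (≡.sym (sum-exponent _ _ s _ _ t)))
      (solve 2 (λ z e → (z :+ z) :+ (e :+ e) := (z :+ e) :+ (z :+ e)) ≡.refl (+ z) (+ E)))))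
    where
    open ℤ.+-*-Solver
    E = exponent (w ℕ.+ w ℕ.+ (y ℕ.+ y) ℕ.+ (y ℕ.+ y) ℕ.+ (z ℕ.+ z) ℕ.+ (z ℕ.+ z)) (w ℕ.+ w) s
      ℕ.+ exponent (y ℕ.+ y) (w ℕ.+ w ℕ.+ (w ℕ.+ w) ℕ.+ (y ℕ.+ y) ℕ.+ (z ℕ.+ z) ℕ.+ (z ℕ.+ z)) t

-- Infinite products, theta series and the triple product for nilpotent q

module NilpotentTheta {c ℓ} (R : CommutativeRing c ℓ) (q : CommutativeRing.Carrier R) (N : ℕ)
  (qᵉ≈0 : ∀ e → N ≤ e → CommutativeRing._≈_ R (Exp._^_ (CommutativeRing.semiring R) q e) (CommutativeRing.0# R))
  where
  open CommutativeRing R hiding (zero)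
  open IntegerCoefficients R using (solve; _:+_; _:*_; _:-_; :-_; _:=_; con)
  open import Algebra.Properties.Ring ring using (-0#≈0#)
  open import Algebra.Properties.Semiring.Exp semiring
  open import Relation.Binary.Reasoning.Setoid setoid
  open Sums R
  open BilateralSums R

  poch : ℕ → ℕ → Carrier
  poch a k = prod N (λ i → 1# - q ^ (a ℕ.+ k ℕ.* i))

  N≤a+ki : ∀ a k {i} → 1 ≤ k → N ≤ i → N ≤ a ℕ.+ k ℕ.* i
  N≤a+ki a k {i} 1≤k N≤i = ℕ.≤-trans N≤i (ℕ.≤-trans
    (ℕ.≤-trans (ℕ.≤-reflexive (≡.sym (ℕ.*-identityˡ i))) (ℕ.*-monoˡ-≤ i 1≤k)) (ℕ.m≤n+m _ a))

  prod-truncate : ∀ {M f} → (∀ i → N ≤ i → f i ≈ 1#) → N ≤ M → prod M f ≈ prod N f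
  prod-truncate {M} {f} f≈1 N≤M =
    trans (reflexive (≡.cong (λ k → prod k f) (≡.sym (ℕ.m∸n+n≡m N≤M)))) (prod-stable (M ∸ N) N f f≈1)

  poch-truncate : ∀ {M} a k → 1 ≤ k → N ≤ M → prod M (λ i → 1# - q ^ (a ℕ.+ k ℕ.* i)) ≈ poch a k
  poch-truncate a k 1≤k N≤M = prod-truncate (λ i N≤i →
    trans (+-congˡ (trans (-‿cong (qᵉ≈0 _ (N≤a+ki a k 1≤k N≤i))) -0#≈0#)) (+-identityʳ 1#)) N≤M

  -- Dissection by the residue of the index modulo n + 1. Truncating at N (n + 1) factors instead of
  -- N gives N full blocks, and exchanging the two products collects the residue classes.
  poch-split : ∀ n a k → 1 ≤ k → poch a k ≈ prod (suc n) (λ j → poch (a ℕ.+ k ℕ.* j) (k ℕ.* suc n))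
  poch-split n a k 1≤k = begin
    poch a k
      ≈⟨ poch-truncate a k 1≤k (ℕ.m≤m*n N (suc n)) ⟨
    prod (N ℕ.* suc n) f
      ≈⟨ prod-blocks N (suc n) f ⟩
    prod N (λ i → prod (suc n) (λ j → f (j ℕ.+ i ℕ.* suc n)))
      ≈⟨ prod-swap N (suc n) (λ i j → f (j ℕ.+ i ℕ.* suc n)) ⟩
    prod (suc n) (λ j → prod N (λ i → f (j ℕ.+ i ℕ.* suc n)))
      ≈⟨ prod-cong (suc n) (λ j → prod-cong N λ i → +-congˡ (-‿cong (^-congʳ q (exponents i j)))) ⟩
    prod (suc n) (λ j → poch (a ℕ.+ k ℕ.* j) (k ℕ.* suc n)) ∎
    where
    f : ℕ → Carrier
    f i = 1# - q ^ (a ℕ.+ k ℕ.* i)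
    exponents : ∀ i j → a ℕ.+ k ℕ.* (j ℕ.+ i ℕ.* suc n) ≡ a ℕ.+ k ℕ.* j ℕ.+ k ℕ.* suc n ℕ.* i
    exponents i j = solveℕ 5 (λ a k j i m → a :+ℕ k :*ℕ (j :+ℕ i :*ℕ m) :=ℕ a :+ℕ k :*ℕ j :+ℕ k :*ℕ m :*ℕ i) ≡.refl a k j i (suc n)
      where open ℕ.+-*-Solver using () renaming (solve to solveℕ; _:+_ to _:+ℕ_; _:*_ to _:*ℕ_; _:=_ to _:=ℕ_)

  geometric : ∀ x n → sum n (x ^_) * (1# - x) ≈ 1# - x ^ n
  geometric x zero = solve 1 (λ x → con (+ 0) :* (con (+ 1) :- x) := con (+ 1) :- con (+ 1)) refl x
  geometric x (suc n) = begin
    (sum n (x ^_) + x ^ n) * (1# - x)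
      ≈⟨ distribʳ _ _ _ ⟩
    sum n (x ^_) * (1# - x) + x ^ n * (1# - x)
      ≈⟨ +-congʳ (geometric x n) ⟩
    1# - x ^ n + x ^ n * (1# - x)
      ≈⟨ solve 2 (λ x y → con (+ 1) :- y :+ y :* (con (+ 1) :- x) := con (+ 1) :- x :* y) refl x (x ^ n) ⟩
    1# - x * x ^ n ∎

  -- By nilpotency the geometric series with N terms is an exact inverse.
  invertible-1-q : ∀ {e} → 1 ≤ e → Invertible (1# - q ^ e)
  invertible-1-q {e} 1≤e = sum N ((q ^ e) ^_) , (begin
    sum N ((q ^ e) ^_) * (1# - q ^ e)  ≈⟨ geometric (q ^ e) N ⟩
    1# - (q ^ e) ^ N                   ≈⟨ +-congˡ (-‿cong (trans (^-assocʳ q e N) (qᵉ≈0 (e ℕ.* N) N≤eN))) ⟩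
    1# - 0#                            ≈⟨ trans (+-congˡ -0#≈0#) (+-identityʳ 1#) ⟩
    1#                                 ∎)
    where N≤eN = ℕ.≤-trans (ℕ.≤-reflexive (≡.sym (ℕ.*-identityˡ N))) (ℕ.*-monoˡ-≤ N 1≤e)

  invertible-poch : ∀ a k → 1 ≤ a → Invertible (poch a k)
  invertible-poch a k 1≤a = invertible-prod N _ λ i → invertible-1-q (ℕ.≤-trans 1≤a (ℕ.m≤m+n _ _))

  -- `σ` stands for 1 or -1, so `σ ^ ∣ z ∣` is σ^z also for negative z. The theta functions of the
  -- overview have σ = -1, the parts P and Q have σ = 1.
  term : Carrier → ℕ → ℕ → ℤ → Carrier
  term σ a b z = σ ^ ∣ z ∣ * q ^ exponent a b z

  theta : Carrier → ℕ → ℕ → Carrier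
  theta σ a b = ∑± N (term σ a b)

  term-vanishes : ∀ σ {a b} → 1 ≤ a → 1 ≤ b → Vanishes N (term σ a b)
  term-vanishes σ 1≤a 1≤b z N≤z =
    trans (*-congˡ (qᵉ≈0 _ (ℕ.≤-trans N≤z (exponent-bound 1≤a 1≤b z)))) (zeroʳ _)

  module TripleProduct (σ : Carrier) (σ²≈1 : σ * σ ≈ 1#) (a b : ℕ) (1≤a : 1 ≤ a) (1≤b : 1 ≤ b) where

    private
      s = a ℕ.+ b
      1≤s = ℕ.≤-trans 1≤a (ℕ.m≤m+n a b)
      p = q ^ s
      A = - (σ * q ^ a)
      B = - (σ * q ^ b)

      AB≈p : A * B ≈ p
      AB≈p = begin
        - (σ * q ^ a) * - (σ * q ^ b)   ≈⟨ solve 3 (λ σ x y → :- (σ :* x) :* :- (σ :* y) := σ :* σ :* (x :* y)) refl _ _ _ ⟩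
        σ * σ * (q ^ a * q ^ b)         ≈⟨ *-cong σ²≈1 (sym (^-homo-* q a b)) ⟩
        1# * p                          ≈⟨ *-identityˡ p ⟩
        p                               ∎

      open Gaussian R p using (gauss; factorial; gauss-factorial)
      open FiniteTripleProduct R A B p AB≈p

      coeff-term : ∀ c j → coeff (- (σ * q ^ c)) j ≈ σ ^ j * q ^ (s ℕ.* triangle j ℕ.+ c ℕ.* j)
      coeff-term c zero = begin
        1#                                  ≈⟨ *-identityˡ 1# ⟨
        1# * 1#                             ≡⟨ ≡.cong (λ e → 1# * q ^ e) (≡.cong₂ ℕ._+_ (ℕ.*-zeroʳ s) (ℕ.*-zeroʳ c)) ⟨
        1# * q ^ (s ℕ.* 0 ℕ.+ c ℕ.* 0)      ∎
      coeff-term c (suc j) = begin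
        - (- (σ * q ^ c) * p ^ j) * coeff (- (σ * q ^ c)) j
          ≈⟨ *-cong (-‿cong (*-congˡ (^-assocʳ q s j))) (coeff-term c j) ⟩
        - (- (σ * q ^ c) * q ^ (s ℕ.* j)) * (σ ^ j * q ^ e)
          ≈⟨ solve 5 (λ σ x y τ z → :- (:- (σ :* x) :* y) :* (τ :* z) := σ :* τ :* (x :* y :* z)) refl σ (q ^ c) (q ^ (s ℕ.* j)) (σ ^ j) (q ^ e) ⟩
        σ ^ suc j * (q ^ c * q ^ (s ℕ.* j) * q ^ e)
          ≈⟨ *-congˡ (trans (^-homo-* q (c ℕ.+ s ℕ.* j) e) (*-congʳ (^-homo-* q c (s ℕ.* j)))) ⟨
        σ ^ suc j * q ^ (c ℕ.+ s ℕ.* j ℕ.+ e)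
          ≡⟨ ≡.cong (λ k → σ ^ suc j * q ^ k) (solveℕ 4 (λ c s j t → c :+ℕ s :*ℕ j :+ℕ (s :*ℕ t :+ℕ c :*ℕ j)
               :=ℕ s :*ℕ (j :+ℕ t) :+ℕ c :*ℕ (conℕ 1 :+ℕ j)) ≡.refl c s j (triangle j)) ⟩
        σ ^ suc j * q ^ (s ℕ.* triangle (suc j) ℕ.+ c ℕ.* suc j) ∎
        where
        e = s ℕ.* triangle j ℕ.+ c ℕ.* j
        open ℕ.+-*-Solver using () renaming (solve to solveℕ; _:+_ to _:+ℕ_; _:*_ to _:*ℕ_; _:=_ to _:=ℕ_; con to conℕ)

      coeffA : ∀ j → coeff A j ≈ term σ a b (+ j)
      coeffA = coeff-term a

      coeffB : ∀ j → coeff B (suc j) ≈ term σ a b -[1+ j ]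
      coeffB j = coeff-term b (suc j)

      coeffA-vanishes : ∀ j → N ≤ j → coeff A j ≈ 0#
      coeffA-vanishes j N≤j = trans (coeffA j) (term-vanishes σ 1≤a 1≤b (+ j) N≤j)

      coeffB-vanishes : ∀ j → N ≤ j → coeff B j ≈ 0#
      coeffB-vanishes zero    N≤j = coeffA-vanishes 0 N≤j
      coeffB-vanishes (suc j) N≤j = trans (coeffB j) (term-vanishes σ 1≤a 1≤b -[1+ j ] N≤j)

      n = N ℕ.+ N
      e = poch s s

      factorial≈ : ∀ {M} → N ≤ M → factorial M ≈ e
      factorial≈ {M} N≤M = trans
        (prod-cong M λ i → +-congˡ (-‿cong (trans (^-assocʳ q s (suc i)) (^-congʳ q (ℕ.*-suc s i)))))
        (poch-truncate s s 1≤s N≤M)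

      -- All three factorials in `gauss-factorial` have at least N factors and hence equal the unit
      -- `e`, one copy of which cancels.
      gauss-limit : ∀ {m l} → N ≤ m → N ≤ l → gauss (m ℕ.+ l) l * e ≈ 1#
      gauss-limit {m} {l} N≤m N≤l = cancelˡ (invertible-poch s s 1≤s) (begin
        e * (gauss (m ℕ.+ l) l * e)                       ≈⟨ solve 2 (λ e g → e :* (g :* e) := g :* e :* e) refl _ _ ⟩
        gauss (m ℕ.+ l) l * e * e                         ≈⟨ *-cong (*-congˡ (factorial≈ N≤l)) (factorial≈ N≤m) ⟨
        gauss (m ℕ.+ l) l * factorial l * factorial m     ≈⟨ gauss-factorial m l ⟩
        factorial (m ℕ.+ l)                               ≈⟨ factorial≈ (ℕ.≤-trans N≤l (ℕ.m≤n+m l m)) ⟩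
        e                                                 ≈⟨ *-identityʳ e ⟨
        e * 1#                                            ∎)

      n∸N≡N : n ∸ N ≡ N
      n∸N≡N = ℕ.m+n∸n≡m N N

      vanishing : ∀ {d} g → d ≈ 0# → e * (d * g) ≈ d
      vanishing {d} g d≈0 = begin
        e * (d * g)   ≈⟨ *-congˡ (trans (*-congʳ d≈0) (zeroˡ g)) ⟩
        e * 0#        ≈⟨ zeroʳ e ⟩
        0#            ≈⟨ d≈0 ⟨
        d             ∎

      -- The passage to the limit is made term by term. Since n = 2N, the index l runs from 0 to 4N
      -- with centre 2N: either l - 2N has absolute value above N and the coefficient vanishes, or l
      -- and 4N - l are both at least N and `gauss-limit` applies.
      Limit : ℕ → Set _
      Limit l = e * (shifted n l * gauss (n ℕ.+ n) l) ≈ shifted n l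

      limit-left : ∀ l → l < N → Limit l
      limit-left l l<N = vanishing _ (trans
        (reflexive (shifted-left n l (ℕ.≤-trans (ℕ.<⇒≤ l<N) (ℕ.m≤m+n N N))))
        (coeffB-vanishes (n ∸ l) (ℕ.≤-trans (ℕ.≤-reflexive (≡.sym n∸N≡N)) (ℕ.∸-monoʳ-≤ n (ℕ.<⇒≤ l<N)))))

      limit-middle : ∀ l → N ≤ l → l ≤ n ℕ.+ N → Limit l
      limit-middle l N≤l l≤n+N = begin
        e * (shifted n l * gauss (n ℕ.+ n) l)
          ≡⟨ ≡.cong (λ k → e * (shifted n l * gauss k l)) (ℕ.m∸n+n≡m l≤2n) ⟨
        e * (shifted n l * gauss (n ℕ.+ n ∸ l ℕ.+ l) l)
          ≈⟨ solve 3 (λ e d g → e :* (d :* g) := d :* (g :* e)) refl _ _ _ ⟩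
        shifted n l * (gauss (n ℕ.+ n ∸ l ℕ.+ l) l * e)
          ≈⟨ *-congˡ (gauss-limit N≤m N≤l) ⟩
        shifted n l * 1#
          ≈⟨ *-identityʳ _ ⟩
        shifted n l ∎
        where
        l≤2n : l ≤ n ℕ.+ n
        l≤2n = ℕ.≤-trans l≤n+N (ℕ.+-monoʳ-≤ n (ℕ.m≤m+n N N))
        N≤m : N ≤ n ℕ.+ n ∸ l
        N≤m = ℕ.≤-trans (ℕ.≤-reflexive (≡.sym (≡.trans (ℕ.[m+n]∸[m+o]≡n∸o n n N) n∸N≡N))) (ℕ.∸-monoʳ-≤ (n ℕ.+ n) l≤n+N)

      limit-right : ∀ l → n ℕ.+ N < l → Limit l
      limit-right l n+N<l = vanishing _ (trans
        (reflexive (≡.trans (≡.cong (shifted n) (≡.sym (ℕ.m+[n∸m]≡n n≤l))) (shifted-right n (l ∸ n))))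
        (coeffA-vanishes (l ∸ n) (ℕ.≤-trans (ℕ.≤-reflexive (≡.sym (ℕ.m+n∸m≡n n N))) (ℕ.∸-monoˡ-≤ n (ℕ.<⇒≤ n+N<l)))))
        where n≤l = ℕ.≤-trans (ℕ.m≤m+n n N) (ℕ.<⇒≤ n+N<l)

      shifted-limit : ∀ l → Limit l
      shifted-limit l = [ limit-left l , (λ N≤l → [ limit-middle l N≤l , limit-right l ]′ (ℕ.≤-<-connex l (n ℕ.+ N))) ]′
        (ℕ.<-≤-connex l N)

      theta-shifted : sum (suc (n ℕ.+ n)) (shifted n) ≈ theta σ a b
      theta-shifted = begin
        sum (suc (n ℕ.+ n)) (shifted n)
          ≡⟨ ≡.cong (λ k → sum k (shifted n)) (ℕ.+-suc n n) ⟨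
        sum (n ℕ.+ suc n) (shifted n)
          ≈⟨ sum-shifted n (suc n) ⟩
        sum n (λ j → coeff B (suc j)) + (sum n (coeff A) + coeff A n)
          -- The window of `theta` is half-open; the extra term at its right end is zero.
          ≈⟨ +-congˡ (trans (+-congˡ (coeffA-vanishes n (ℕ.m≤m+n N N))) (+-identityʳ _)) ⟩
        sum n (λ j → coeff B (suc j)) + sum n (coeff A)
          ≈⟨ +-comm _ _ ⟩
        sum n (coeff A) + sum n (λ j → coeff B (suc j))
          ≈⟨ sum-+ n _ _ ⟨
        sum n (λ j → coeff A j + coeff B (suc j))
          ≈⟨ sum-cong n (λ j _ → +-cong (coeffA j) (coeffB j)) ⟩
        sum n (λ j → term σ a b (+ j) + term σ a b -[1+ j ])
          ≡⟨ ∑±-as-sum n (term σ a b) ⟨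
        ∑± n (term σ a b)
          ≈⟨ ∑±-stable (term-vanishes σ 1≤a 1≤b) (ℕ.m≤m+n N N) ⟩
        theta σ a b ∎

      factor : ∀ c i → 1# - - (σ * q ^ c) * p ^ i ≈ 1# + σ * q ^ (c ℕ.+ s ℕ.* i)
      factor c i = begin
        1# - - (σ * q ^ c) * p ^ i
          ≈⟨ solve 3 (λ σ x y → con (+ 1) :- :- (σ :* x) :* y := con (+ 1) :+ σ :* (x :* y)) refl _ _ _ ⟩
        1# + σ * (q ^ c * p ^ i)
          ≈⟨ +-congˡ (*-congˡ (trans (*-congˡ (^-assocʳ q s i)) (sym (^-homo-* q c (s ℕ.* i))))) ⟩
        1# + σ * q ^ (c ℕ.+ s ℕ.* i) ∎

      factors : ∀ c → prod n (λ i → 1# - - (σ * q ^ c) * p ^ i) ≈ prod N (λ i → 1# + σ * q ^ (c ℕ.+ s ℕ.* i))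
      factors c = trans (prod-cong n (factor c)) (prod-truncate
        (λ i N≤i → trans (+-congˡ (trans (*-congˡ (qᵉ≈0 _ (N≤a+ki c s 1≤s N≤i))) (zeroʳ σ))) (+-identityʳ 1#))
        (ℕ.m≤m+n N N))

    -- Multiplication by (p; p)_∞ turns every Gaussian coefficient that meets a nonzero term into 1,
    -- so the finite identity becomes the infinite one.
    triple-product : theta σ a b ≈ poch s s *
      (prod N (λ i → 1# + σ * q ^ (b ℕ.+ s ℕ.* i)) * prod N (λ i → 1# + σ * q ^ (a ℕ.+ s ℕ.* i)))
    triple-product = begin
      theta σ a b
        ≈⟨ theta-shifted ⟨
      sum (suc (n ℕ.+ n)) (shifted n)
        ≈⟨ sum-cong (suc (n ℕ.+ n)) (λ l _ → shifted-limit l) ⟨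
      sum (suc (n ℕ.+ n)) (λ l → e * (shifted n l * gauss (n ℕ.+ n) l))
        ≈⟨ sum-*ˡ (suc (n ℕ.+ n)) e _ ⟩
      e * weighted n (n ℕ.+ n)
        ≈⟨ *-congˡ (trans (finite-triple-product n n) (*-cong (factors b) (factors a))) ⟩
      e * (prod N (λ i → 1# + σ * q ^ (b ℕ.+ s ℕ.* i)) * prod N (λ i → 1# + σ * q ^ (a ℕ.+ s ℕ.* i))) ∎

  open TripleProduct public using (triple-product)

-- Products of two thetas, and Gauss' product for ψ

module ThetaIdentities {c ℓ} (R : CommutativeRing c ℓ) (q : CommutativeRing.Carrier R) (N : ℕ)
  (qᵉ≈0 : ∀ e → N ≤ e → CommutativeRing._≈_ R (Exp._^_ (CommutativeRing.semiring R) q e) (CommutativeRing.0# R))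
  where
  open CommutativeRing R hiding (zero)
  open IntegerCoefficients R using (solve; _:+_; _:*_; _:-_; :-_; _:=_; con)
  open import Algebra.Properties.Semiring.Exp semiring
  open import Relation.Binary.Reasoning.Setoid setoid
  open Sums R
  open BilateralSums R
  open NilpotentTheta R q N qᵉ≈0

  1^n≈1 : ∀ n → 1# ^ n ≈ 1#
  1^n≈1 zero    = refl
  1^n≈1 (suc n) = trans (*-identityˡ _) (1^n≈1 n)

  term₊ : ∀ a b z → term 1# a b z ≈ q ^ exponent a b z
  term₊ a b z = trans (*-congʳ (1^n≈1 (∣ z ∣))) (*-identityˡ _)

  -1² : - 1# * - 1# ≈ 1#
  -1² = solve 0 (:- con (+ 1) :* :- con (+ 1) := con (+ 1)) refl

  sign : ℤ → Carrier
  sign z = (- 1#) ^ ∣ z ∣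

  sign-suc : ∀ z → sign (ℤ.suc z) ≈ - 1# * sign z
  sign-suc (+ n)        = refl
  sign-suc -[1+ zero ]  = solve 0 (con (+ 1) := :- con (+ 1) :* (:- con (+ 1) :* con (+ 1))) refl
  sign-suc -[1+ suc n ] = solve 1 (λ x → x := :- con (+ 1) :* (:- con (+ 1) :* x)) refl _

  -- `∣_∣` is not additive, but its parity is; unit steps by `sign-suc` avoid comparing the signs of
  -- s and t.
  sign-+ : ∀ s t → sign (s ℤ.+ t) ≈ sign s * sign t
  sign-+ (+ zero) t = trans (reflexive (≡.cong sign (ℤ.+-identityˡ t))) (sym (*-identityˡ _))
  sign-+ (+ suc m) t = begin
    sign (+ suc m ℤ.+ t)              ≡⟨ ≡.cong sign (ℤ.+-assoc (+ 1) (+ m) t) ⟩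
    sign (ℤ.suc (+ m ℤ.+ t))          ≈⟨ sign-suc (+ m ℤ.+ t) ⟩
    - 1# * sign (+ m ℤ.+ t)           ≈⟨ *-congˡ (sign-+ (+ m) t) ⟩
    - 1# * (sign (+ m) * sign t)      ≈⟨ *-assoc _ _ _ ⟨
    sign (+ suc m) * sign t           ∎
  sign-+ -[1+ m ] t = begin
    sign (-[1+ m ] ℤ.+ t)
      ≈⟨ solve 1 (λ x → x := :- con (+ 1) :* (:- con (+ 1) :* x)) refl _ ⟩
    - 1# * (- 1# * sign (-[1+ m ] ℤ.+ t))
      ≈⟨ *-congˡ (sign-suc (-[1+ m ] ℤ.+ t)) ⟨
    - 1# * sign (ℤ.suc (-[1+ m ] ℤ.+ t))
      ≡⟨ ≡.cong (λ z → - 1# * sign z) (≡.trans (≡.sym (ℤ.+-assoc (+ 1) -[1+ m ] t)) (≡.cong (ℤ._+ t) (suc-neg m))) ⟩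
    - 1# * sign (ℤ.- + m ℤ.+ t)
      ≈⟨ *-congˡ (negative m) ⟩
    - 1# * (sign (ℤ.- + m) * sign t)
      ≈⟨ *-assoc _ _ _ ⟨
    - 1# * sign (ℤ.- + m) * sign t
      ≡⟨ ≡.cong (λ k → - 1# * (- 1#) ^ k * sign t) (ℤ.∣-i∣≡∣i∣ (+ m)) ⟩
    sign -[1+ m ] * sign t ∎
    where
    negative : ∀ m → sign (ℤ.- + m ℤ.+ t) ≈ sign (ℤ.- + m) * sign t
    negative zero    = sign-+ (+ zero) t
    negative (suc m) = sign-+ -[1+ m ] t
    suc-neg : ∀ m → ℤ.suc -[1+ m ] ≡ ℤ.- + m
    suc-neg zero    = ≡.refl
    suc-neg (suc m) = ≡.refl

  sign-double : ∀ s → sign (s ℤ.+ s) ≈ 1#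
  sign-double s = trans (sign-+ s s) (square (∣ s ∣))
    where
    square : ∀ n → (- 1#) ^ n * (- 1#) ^ n ≈ 1#
    square zero    = *-identityˡ 1#
    square (suc n) = trans (solve 1 (λ x → (:- con (+ 1) :* x) :* (:- con (+ 1) :* x) := x :* x) refl _) (square n)

  term₋-* : ∀ a b c d s t → term (- 1#) a b s * term (- 1#) c d t
                          ≈ sign (s ℤ.+ t) * q ^ (exponent a b s ℕ.+ exponent c d t)
  term₋-* a b c d s t = begin
    (sign s * q ^ exponent a b s) * (sign t * q ^ exponent c d t)
      ≈⟨ solve 4 (λ a b c d → (a :* b) :* (c :* d) := (a :* c) :* (b :* d)) refl _ _ _ _ ⟩
    (sign s * sign t) * (q ^ exponent a b s * q ^ exponent c d t)
      ≈⟨ *-cong (sign-+ s t) (^-homo-* q (exponent a b s) (exponent c d t)) ⟨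
    sign (s ℤ.+ t) * q ^ (exponent a b s ℕ.+ exponent c d t) ∎

  term₊-* : ∀ a b c d s t → term 1# a b s * term 1# c d t ≈ q ^ (exponent a b s ℕ.+ exponent c d t)
  term₊-* a b c d s t = trans (*-cong (term₊ a b s) (term₊ c d t)) (sym (^-homo-* q (exponent a b s) (exponent c d t)))

  -- The addition formula θ(x y) θ(x / y) = P(x) Q(y) - (x / y) Q(x) P(y). The exponents y, x = y +
  -- z and h = w + y + z are described by their gaps, so that every exponent is a sum. The sign of a
  -- term is (-1)^(m+n), constant on each parity class, which is why only the series with σ = 1
  -- remain.
  theta-product : ∀ w y z → 1 ≤ w → 1 ≤ y → 1 ≤ z →
    theta (- 1#) (y ℕ.+ y ℕ.+ z) (w ℕ.+ w ℕ.+ z) * theta (- 1#) z (w ℕ.+ w ℕ.+ (y ℕ.+ y) ℕ.+ z)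
    ≈ theta 1# (y ℕ.+ y ℕ.+ (z ℕ.+ z)) (w ℕ.+ w ℕ.+ (w ℕ.+ w) ℕ.+ (y ℕ.+ y) ℕ.+ (z ℕ.+ z))
        * theta 1# (w ℕ.+ w ℕ.+ (y ℕ.+ y) ℕ.+ (y ℕ.+ y) ℕ.+ (z ℕ.+ z)) (w ℕ.+ w ℕ.+ (z ℕ.+ z))
      - q ^ z * (theta 1# (w ℕ.+ w ℕ.+ (y ℕ.+ y) ℕ.+ (y ℕ.+ y) ℕ.+ (z ℕ.+ z) ℕ.+ (z ℕ.+ z)) (w ℕ.+ w)
        * theta 1# (y ℕ.+ y) (w ℕ.+ w ℕ.+ (w ℕ.+ w) ℕ.+ (y ℕ.+ y) ℕ.+ (z ℕ.+ z) ℕ.+ (z ℕ.+ z)))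
  theta-product w y z 1≤w 1≤y 1≤z = begin
    theta (- 1#) a₁ b₁ * theta (- 1#) a₂ b₂
      ≈⟨ ∑±-product (term-vanishes (- 1#) {a₁} {b₁} 1≤a₁ 1≤b₁) (term-vanishes (- 1#) {a₂} {b₂} 1≤z 1≤b₂) ⟩
    ∑± N (λ s → ∑± (N ℕ.+ N) (λ t → term (- 1#) a₁ b₁ (t ℤ.+ s) * term (- 1#) a₂ b₂ (s ℤ.- t)))
      + ∑± N (λ s → ∑± (N ℕ.+ N) (λ t → term (- 1#) a₁ b₁ (t ℤ.+ s) * term (- 1#) a₂ b₂ (+ 1 ℤ.+ (s ℤ.- t))))
      ≈⟨ +-cong (∑±-cong N λ s _ → ∑±-cong (N ℕ.+ N) λ t _ → even s t)
                (∑±-cong N λ s _ → trans (∑±-cong (N ℕ.+ N) λ t _ → odd s t) (∑±-*ˡ (N ℕ.+ N) (- q ^ z) _)) ⟩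
    ∑± N (λ s → ∑± (N ℕ.+ N) (λ t → term 1# a₃ b₃ s * term 1# a₄ b₄ t))
      + ∑± N (λ s → - q ^ z * ∑± (N ℕ.+ N) (λ t → term 1# a₅ b₅ s * term 1# a₆ b₆ t))
      ≈⟨ +-cong (∑±-* N (N ℕ.+ N) _ _) (trans (∑±-*ˡ N (- q ^ z) _) (*-congˡ (∑±-* N (N ℕ.+ N) _ _))) ⟩
    theta 1# a₃ b₃ * ∑± (N ℕ.+ N) (term 1# a₄ b₄) + - q ^ z * (theta 1# a₅ b₅ * ∑± (N ℕ.+ N) (term 1# a₆ b₆))
      ≈⟨ +-cong (*-congˡ (∑±-stable (term-vanishes 1# {a₄} {b₄} 1≤a₄ 1≤b₄) (ℕ.m≤m+n N N)))
                (*-congˡ (*-congˡ (∑±-stable (term-vanishes 1# {a₆} {b₆} 1≤a₆ 1≤b₆) (ℕ.m≤m+n N N)))) ⟩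
    theta 1# a₃ b₃ * theta 1# a₄ b₄ + - q ^ z * (theta 1# a₅ b₅ * theta 1# a₆ b₆)
      ≈⟨ solve 3 (λ x y z → x :+ :- y :* z := x :- y :* z) refl _ _ _ ⟩
    theta 1# a₃ b₃ * theta 1# a₄ b₄ - q ^ z * (theta 1# a₅ b₅ * theta 1# a₆ b₆) ∎
    where
    a₁ = y ℕ.+ y ℕ.+ z
    b₁ = w ℕ.+ w ℕ.+ z
    a₂ = z
    b₂ = w ℕ.+ w ℕ.+ (y ℕ.+ y) ℕ.+ z
    a₃ = y ℕ.+ y ℕ.+ (z ℕ.+ z)
    b₃ = w ℕ.+ w ℕ.+ (w ℕ.+ w) ℕ.+ (y ℕ.+ y) ℕ.+ (z ℕ.+ z)
    a₄ = w ℕ.+ w ℕ.+ (y ℕ.+ y) ℕ.+ (y ℕ.+ y) ℕ.+ (z ℕ.+ z)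
    b₄ = w ℕ.+ w ℕ.+ (z ℕ.+ z)
    a₅ = w ℕ.+ w ℕ.+ (y ℕ.+ y) ℕ.+ (y ℕ.+ y) ℕ.+ (z ℕ.+ z) ℕ.+ (z ℕ.+ z)
    b₅ = w ℕ.+ w
    a₆ = y ℕ.+ y
    b₆ = w ℕ.+ w ℕ.+ (w ℕ.+ w) ℕ.+ (y ℕ.+ y) ℕ.+ (z ℕ.+ z) ℕ.+ (z ℕ.+ z)
    after : ∀ m {n} → 1 ≤ n → 1 ≤ m ℕ.+ n
    after m {n} 1≤n = ℕ.≤-trans 1≤n (ℕ.m≤n+m n m)
    1≤a₁ = after (y ℕ.+ y) 1≤z
    1≤b₁ = after (w ℕ.+ w) 1≤z
    1≤b₂ = after (w ℕ.+ w ℕ.+ (y ℕ.+ y)) 1≤z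
    1≤z+z = after z 1≤z
    1≤a₄ = after (w ℕ.+ w ℕ.+ (y ℕ.+ y) ℕ.+ (y ℕ.+ y)) 1≤z+z
    1≤b₄ = after (w ℕ.+ w) 1≤z+z
    1≤a₆ = after y 1≤y
    1≤b₆ = after (w ℕ.+ w ℕ.+ (w ℕ.+ w) ℕ.+ (y ℕ.+ y) ℕ.+ (z ℕ.+ z)) 1≤z+z
    open ℤ.+-*-Solver using () renaming (solve to solveℤ; _:+_ to _:+ℤ_; _:-_ to _:-ℤ_; _:=_ to _:=ℤ_; con to conℤ)
    even : ∀ s t → term (- 1#) a₁ b₁ (t ℤ.+ s) * term (- 1#) a₂ b₂ (s ℤ.- t) ≈ term 1# a₃ b₃ s * term 1# a₄ b₄ t
    even s t = begin
      term (- 1#) a₁ b₁ (t ℤ.+ s) * term (- 1#) a₂ b₂ (s ℤ.- t)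
        ≈⟨ term₋-* a₁ b₁ a₂ b₂ (t ℤ.+ s) (s ℤ.- t) ⟩
      sign (t ℤ.+ s ℤ.+ (s ℤ.- t)) * q ^ (exponent a₁ b₁ (t ℤ.+ s) ℕ.+ exponent a₂ b₂ (s ℤ.- t))
        ≡⟨ ≡.cong₂ (λ z e → sign z * q ^ e)
             (solveℤ 2 (λ s t → t :+ℤ s :+ℤ (s :-ℤ t) :=ℤ s :+ℤ s) ≡.refl s t) (exponent-even w y z s t) ⟩
      sign (s ℤ.+ s) * q ^ (exponent a₃ b₃ s ℕ.+ exponent a₄ b₄ t)
        ≈⟨ trans (*-congʳ (sign-double s)) (*-identityˡ _) ⟩
      q ^ (exponent a₃ b₃ s ℕ.+ exponent a₄ b₄ t)
        ≈⟨ term₊-* a₃ b₃ a₄ b₄ s t ⟨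
      term 1# a₃ b₃ s * term 1# a₄ b₄ t ∎
    odd : ∀ s t → term (- 1#) a₁ b₁ (t ℤ.+ s) * term (- 1#) a₂ b₂ (+ 1 ℤ.+ (s ℤ.- t))
                ≈ - q ^ z * (term 1# a₅ b₅ s * term 1# a₆ b₆ t)
    odd s t = begin
      term (- 1#) a₁ b₁ (t ℤ.+ s) * term (- 1#) a₂ b₂ (+ 1 ℤ.+ (s ℤ.- t))
        ≈⟨ term₋-* a₁ b₁ a₂ b₂ (t ℤ.+ s) (+ 1 ℤ.+ (s ℤ.- t)) ⟩
      sign (t ℤ.+ s ℤ.+ (+ 1 ℤ.+ (s ℤ.- t))) * q ^ (exponent a₁ b₁ (t ℤ.+ s) ℕ.+ exponent a₂ b₂ (+ 1 ℤ.+ (s ℤ.- t)))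
        ≡⟨ ≡.cong₂ (λ z e → sign z * q ^ e)
             (solveℤ 2 (λ s t → t :+ℤ s :+ℤ (conℤ (+ 1) :+ℤ (s :-ℤ t)) :=ℤ conℤ (+ 1) :+ℤ (s :+ℤ s)) ≡.refl s t)
             (exponent-odd w y z s t) ⟩
      sign (ℤ.suc (s ℤ.+ s)) * q ^ (z ℕ.+ (exponent a₅ b₅ s ℕ.+ exponent a₆ b₆ t))
        ≈⟨ *-cong (trans (sign-suc (s ℤ.+ s)) (*-congˡ (sign-double s)))
                  (^-homo-* q z (exponent a₅ b₅ s ℕ.+ exponent a₆ b₆ t)) ⟩
      - 1# * 1# * (q ^ z * q ^ (exponent a₅ b₅ s ℕ.+ exponent a₆ b₆ t))
        ≈⟨ solve 2 (λ x y → :- con (+ 1) :* con (+ 1) :* (x :* y) := :- x :* y) refl _ _ ⟩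
      - q ^ z * q ^ (exponent a₅ b₅ s ℕ.+ exponent a₆ b₆ t)
        ≈⟨ *-congˡ (term₊-* a₅ b₅ a₆ b₆ s t) ⟨
      - q ^ z * (term 1# a₅ b₅ s * term 1# a₆ b₆ t) ∎

  theta₋-product : ∀ a b → 1 ≤ a → 1 ≤ b →
    theta (- 1#) a b ≈ poch (a ℕ.+ b) (a ℕ.+ b) * (poch b (a ℕ.+ b) * poch a (a ℕ.+ b))
  theta₋-product a b 1≤a 1≤b = trans (triple-product (- 1#) -1² a b 1≤a 1≤b)
    (*-congˡ (*-cong (prod-cong N λ i → factor _) (prod-cong N λ i → factor _)))
    where
    factor : ∀ x → 1# + - 1# * x ≈ 1# - x
    factor x = solve 1 (λ x → con (+ 1) :+ :- con (+ 1) :* x := con (+ 1) :- x) refl x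

  poch-double : ∀ a k → poch a k * prod N (λ i → 1# + 1# * q ^ (a ℕ.+ k ℕ.* i)) ≈ poch (a ℕ.+ a) (k ℕ.+ k)
  poch-double a k = trans (sym (prod-* N _ _)) (prod-cong N λ i → begin
    (1# - q ^ (a ℕ.+ k ℕ.* i)) * (1# + 1# * q ^ (a ℕ.+ k ℕ.* i))
      ≈⟨ solve 1 (λ x → (con (+ 1) :- x) :* (con (+ 1) :+ con (+ 1) :* x) := con (+ 1) :- x :* x) refl _ ⟩
    1# - q ^ (a ℕ.+ k ℕ.* i) * q ^ (a ℕ.+ k ℕ.* i)
      ≈⟨ +-congˡ (-‿cong (^-homo-* q (a ℕ.+ k ℕ.* i) (a ℕ.+ k ℕ.* i))) ⟨
    1# - q ^ (a ℕ.+ k ℕ.* i ℕ.+ (a ℕ.+ k ℕ.* i))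
      ≡⟨ ≡.cong (λ e → 1# - q ^ e) (solveℕ 3 (λ a k i → (a :+ℕ k :*ℕ i) :+ℕ (a :+ℕ k :*ℕ i)
           :=ℕ (a :+ℕ a) :+ℕ (k :+ℕ k) :*ℕ i) ≡.refl a k i) ⟩
    1# - q ^ (a ℕ.+ a ℕ.+ (k ℕ.+ k) ℕ.* i) ∎)
    where open ℕ.+-*-Solver using () renaming (solve to solveℕ; _:+_ to _:+ℕ_; _:*_ to _:*ℕ_; _:=_ to _:=ℕ_)

  poch-halves : ∀ a k → 1 ≤ k → poch a k ≈ poch a (k ℕ.+ k) * poch (a ℕ.+ k) (k ℕ.+ k)
  poch-halves a k 1≤k = begin
    poch a k
      ≈⟨ poch-split 1 a k 1≤k ⟩
    1# * poch (a ℕ.+ k ℕ.* 0) (k ℕ.* 2) * poch (a ℕ.+ k ℕ.* 1) (k ℕ.* 2)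
      ≈⟨ *-congʳ (*-identityˡ _) ⟩
    poch (a ℕ.+ k ℕ.* 0) (k ℕ.* 2) * poch (a ℕ.+ k ℕ.* 1) (k ℕ.* 2)
      ≡⟨ ≡.cong₂ _*_
           (≡.cong₂ poch (solveℕ 2 (λ a k → a :+ℕ k :*ℕ conℕ 0 :=ℕ a) ≡.refl a k) twice)
           (≡.cong₂ poch (solveℕ 2 (λ a k → a :+ℕ k :*ℕ conℕ 1 :=ℕ a :+ℕ k) ≡.refl a k) twice) ⟩
    poch a (k ℕ.+ k) * poch (a ℕ.+ k) (k ℕ.+ k) ∎
    where
    open ℕ.+-*-Solver using () renaming (solve to solveℕ; _:+_ to _:+ℕ_; _:*_ to _:*ℕ_; _:=_ to _:=ℕ_; con to conℕ)
    twice = solveℕ 1 (λ k → k :*ℕ conℕ 2 :=ℕ k :+ℕ k) ≡.refl k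

  -- ψ(q²ᵏ)
  psi : ℕ → Carrier
  psi k = sum (N ℕ.+ N) (λ i → q ^ (k ℕ.* (i ℕ.* suc i)))

  -- The indices i = 2j and i = 2j + 1 become the indices j and -1 - j of a bilateral series of
  -- period 8k; the 2N terms of `psi` fill its window exactly.
  psi-theta : ∀ k → psi k ≈ theta 1# (6 ℕ.* k) (2 ℕ.* k)
  psi-theta k = begin
    psi k
      ≈⟨ sum-pairs N _ ⟩
    sum N (λ j → q ^ (k ℕ.* ((j ℕ.+ j) ℕ.* suc (j ℕ.+ j))) + q ^ (k ℕ.* (suc (j ℕ.+ j) ℕ.* suc (suc (j ℕ.+ j)))))
      ≈⟨ sum-cong N (λ j _ → +-cong
           (trans (^-congʳ q (even j)) (sym (term₊ (6 ℕ.* k) (2 ℕ.* k) (+ j))))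
           (trans (^-congʳ q (odd j)) (sym (term₊ (6 ℕ.* k) (2 ℕ.* k) -[1+ j ])))) ⟩
    sum N (λ j → term 1# (6 ℕ.* k) (2 ℕ.* k) (+ j) + term 1# (6 ℕ.* k) (2 ℕ.* k) -[1+ j ])
      ≡⟨ ∑±-as-sum N _ ⟨
    theta 1# (6 ℕ.* k) (2 ℕ.* k) ∎
    where
    open ℕ.+-*-Solver using () renaming (solve to solveℕ; _:+_ to _:+ℕ_; _:*_ to _:*ℕ_; _:=_ to _:=ℕ_; con to conℕ)
    even : ∀ j → k ℕ.* ((j ℕ.+ j) ℕ.* suc (j ℕ.+ j)) ≡ exponent (6 ℕ.* k) (2 ℕ.* k) (+ j)
    even j = ≡.trans
      (solveℕ 2 (λ k j → k :*ℕ ((j :+ℕ j) :*ℕ (conℕ 1 :+ℕ (j :+ℕ j))) :=ℕ k :*ℕ (conℕ 4 :*ℕ (j :*ℕ j) :+ℕ conℕ 2 :*ℕ j)) ≡.refl k j)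
      (≡.trans (≡.cong (λ s → k ℕ.* (4 ℕ.* s ℕ.+ 2 ℕ.* j)) (≡.sym (triangle-double j)))
      (solveℕ 3 (λ k j t → k :*ℕ (conℕ 4 :*ℕ (t :+ℕ t :+ℕ j) :+ℕ conℕ 2 :*ℕ j)
        :=ℕ (conℕ 6 :*ℕ k :+ℕ conℕ 2 :*ℕ k) :*ℕ t :+ℕ conℕ 6 :*ℕ k :*ℕ j) ≡.refl k j (triangle j)))
    odd : ∀ j → k ℕ.* (suc (j ℕ.+ j) ℕ.* suc (suc (j ℕ.+ j))) ≡ exponent (6 ℕ.* k) (2 ℕ.* k) -[1+ j ]
    odd j = ≡.trans
      (solveℕ 2 (λ k j → k :*ℕ ((conℕ 1 :+ℕ (j :+ℕ j)) :*ℕ (conℕ 2 :+ℕ (j :+ℕ j)))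
        :=ℕ k :*ℕ (conℕ 4 :*ℕ (j :*ℕ j) :+ℕ conℕ 6 :*ℕ j :+ℕ conℕ 2)) ≡.refl k j)
      (≡.trans (≡.cong (λ s → k ℕ.* (4 ℕ.* s ℕ.+ 6 ℕ.* j ℕ.+ 2)) (≡.sym (triangle-double j)))
      (solveℕ 3 (λ k j t → k :*ℕ (conℕ 4 :*ℕ (t :+ℕ t :+ℕ j) :+ℕ conℕ 6 :*ℕ j :+ℕ conℕ 2)
        :=ℕ (conℕ 6 :*ℕ k :+ℕ conℕ 2 :*ℕ k) :*ℕ (j :+ℕ t) :+ℕ conℕ 2 :*ℕ k :*ℕ (conℕ 1 :+ℕ j)) ≡.refl k j (triangle j)))

  -- The triple product supplies factors 1 + x for the classes 2k and 6k modulo 8k, and (q^(2k);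
  -- q^(4k))_∞ supplies the matching 1 - x. The products 1 - x² form (q^(4k); q^(8k))_∞, which
  -- (q^(8k); q^(8k))_∞ completes.
  psi-product : ∀ k → 1 ≤ k → psi k * poch (2 ℕ.* k) (4 ℕ.* k) ≈ poch (4 ℕ.* k) (4 ℕ.* k)
  psi-product k 1≤k = begin
    psi k * poch (2 ℕ.* k) (4 ℕ.* k)
      ≈⟨ *-cong (trans (psi-theta k) (triple-product 1# (*-identityˡ 1#) a b (1≤* 5) (1≤* 1)))
                (trans (poch-halves b (4 ℕ.* k) (1≤* 3)) (reflexive (≡.cong₂ _*_ (≡.cong (poch b) 4k+4k) (≡.cong₂ poch 2k+4k 4k+4k)))) ⟩
    poch s s * (P b * P a) * (poch b s * poch a s)
      ≈⟨ solve 5 (λ e x y u v → e :* (x :* y) :* (u :* v) := (u :* x) :* (v :* y) :* e) refl _ _ _ _ _ ⟩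
    (poch b s * P b) * (poch a s * P a) * poch s s
      ≈⟨ *-congʳ (*-cong (poch-double b s) (poch-double a s)) ⟩
    poch (b ℕ.+ b) (s ℕ.+ s) * poch (a ℕ.+ a) (s ℕ.+ s) * poch s s
      ≡⟨ ≡.cong (λ c → poch (b ℕ.+ b) (s ℕ.+ s) * poch c (s ℕ.+ s) * poch s s) a+a ⟩
    poch (b ℕ.+ b) (s ℕ.+ s) * poch (b ℕ.+ b ℕ.+ s) (s ℕ.+ s) * poch s s
      ≈⟨ *-congʳ (poch-halves (b ℕ.+ b) s (ℕ.≤-trans (1≤* 5) (ℕ.m≤m+n a b))) ⟨
    poch (b ℕ.+ b) s * poch s s
      ≡⟨ ≡.cong₂ _*_ (≡.cong₂ poch b+b (≡.sym 4k+4k)) (≡.cong₂ poch (≡.sym 4k+4k) (≡.sym 4k+4k)) ⟩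
    poch (4 ℕ.* k) (4 ℕ.* k ℕ.+ 4 ℕ.* k) * poch (4 ℕ.* k ℕ.+ 4 ℕ.* k) (4 ℕ.* k ℕ.+ 4 ℕ.* k)
      ≈⟨ poch-halves (4 ℕ.* k) (4 ℕ.* k) (1≤* 3) ⟨
    poch (4 ℕ.* k) (4 ℕ.* k) ∎
    where
    a = 6 ℕ.* k
    b = 2 ℕ.* k
    s = a ℕ.+ b
    P : ℕ → Carrier
    P c = prod N (λ i → 1# + 1# * q ^ (c ℕ.+ s ℕ.* i))
    1≤* : ∀ n → 1 ≤ suc n ℕ.* k
    1≤* n = ℕ.≤-trans 1≤k (ℕ.m≤m+n k (n ℕ.* k))
    open ℕ.+-*-Solver using () renaming (solve to solveℕ; _:+_ to _:+ℕ_; _:*_ to _:*ℕ_; _:=_ to _:=ℕ_; con to conℕ)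
    4k+4k : 4 ℕ.* k ℕ.+ 4 ℕ.* k ≡ s
    4k+4k = solveℕ 1 (λ k → conℕ 4 :*ℕ k :+ℕ conℕ 4 :*ℕ k :=ℕ conℕ 6 :*ℕ k :+ℕ conℕ 2 :*ℕ k) ≡.refl k
    2k+4k : 2 ℕ.* k ℕ.+ 4 ℕ.* k ≡ a
    2k+4k = solveℕ 1 (λ k → conℕ 2 :*ℕ k :+ℕ conℕ 4 :*ℕ k :=ℕ conℕ 6 :*ℕ k) ≡.refl k
    a+a : a ℕ.+ a ≡ b ℕ.+ b ℕ.+ s
    a+a = solveℕ 1 (λ k → conℕ 6 :*ℕ k :+ℕ conℕ 6 :*ℕ k :=ℕ conℕ 2 :*ℕ k :+ℕ conℕ 2 :*ℕ k :+ℕ (conℕ 6 :*ℕ k :+ℕ conℕ 2 :*ℕ k)) ≡.refl k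
    b+b : b ℕ.+ b ≡ 4 ℕ.* k
    b+b = solveℕ 1 (λ k → conℕ 2 :*ℕ k :+ℕ conℕ 2 :*ℕ k :=ℕ conℕ 4 :*ℕ k) ≡.refl k

-- Weierstrass' relation and the difference of the two ψ series

module PsiDifference {c ℓ} (R : CommutativeRing c ℓ) (q : CommutativeRing.Carrier R) (N : ℕ)
  (qᵉ≈0 : ∀ e → N ≤ e → CommutativeRing._≈_ R (Exp._^_ (CommutativeRing.semiring R) q e) (CommutativeRing.0# R))
  where
  open CommutativeRing R hiding (zero)
  open IntegerCoefficients R using (solve; _:*_; _:-_; _:^_; _:=_; con)
  open import Algebra.Properties.Semiring.Exp semiring
  open import Algebra.Properties.Ring ring using (-‿distribˡ-*)
  open import Relation.Binary.Reasoning.Setoid setoid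
  open Sums R
  open NilpotentTheta R q N qᵉ≈0
  open ThetaIdentities R q N qᵉ≈0

  private
    1≤ : ∀ {n} → 1 ≤ suc n
    1≤ = s≤s z≤n

    T : ℕ → ℕ → Carrier
    T = theta (- 1#)

    Θ : ℕ → ℕ → Carrier
    Θ a b = poch b 20 * poch a 20

    f = poch 20 20

  -- Weierstrass' relation for x, y, u, v = q⁸, q⁵, q⁶, q² in base q²⁰: by theta-product each product
  -- of two thetas is a 2 × 2 minor, and the relation is Plücker's.
  weierstrass : T 13 7 * T 3 17 * (T 8 12 * T 4 16) - T 10 10 * T 6 14 * (T 11 9 * T 1 19)
              ≈ q * (T 7 13 * T 3 17 * (T 14 6 * T 2 18))
  weierstrass = begin
    T 13 7 * T 3 17 * (T 8 12 * T 4 16) - T 10 10 * T 6 14 * (T 11 9 * T 1 19)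
      ≈⟨ +-cong (*-cong (theta-product 2 5 3 1≤ 1≤ 1≤) (theta-product 4 2 4 1≤ 1≤ 1≤))
           (-‿cong (*-cong (theta-product 2 2 6 1≤ 1≤ 1≤) (theta-product 4 5 1 1≤ 1≤ 1≤))) ⟩
    (P₈ * Q₅ - q ^ 3 * (Q₈ * P₅)) * (P₆ * Q₂ - q ^ 4 * (Q₆ * P₂))
      - (P₈ * Q₂ - q ^ 6 * (Q₈ * P₂)) * (P₆ * Q₅ - q ^ 1 * (Q₆ * P₅))
      -- Each bracket is q^x times the determinant of the rows (q^(-x) P_x, Q_x) and (q^(-y) P_y,
      -- Q_y). Both products on the left carry q^(8+6), the one on the right q^(5+8); hence the
      -- factor q.
      ≈⟨ solve 9 (λ q P₂ Q₂ P₅ Q₅ P₆ Q₆ P₈ Q₈ →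
           (P₈ :* Q₅ :- q :^ 3 :* (Q₈ :* P₅)) :* (P₆ :* Q₂ :- q :^ 4 :* (Q₆ :* P₂))
             :- (P₈ :* Q₂ :- q :^ 6 :* (Q₈ :* P₂)) :* (P₆ :* Q₅ :- q :^ 1 :* (Q₆ :* P₅))
           := q :* ((P₅ :* Q₂ :- q :^ 3 :* (Q₅ :* P₂)) :* (P₈ :* Q₆ :- q :^ 2 :* (Q₈ :* P₆))))
           refl q P₂ Q₂ P₅ Q₅ P₆ Q₆ P₈ Q₈ ⟩
    q * ((P₅ * Q₂ - q ^ 3 * (Q₅ * P₂)) * (P₈ * Q₆ - q ^ 2 * (Q₈ * P₆)))
      ≈⟨ *-congˡ (*-cong (theta-product 5 2 3 1≤ 1≤ 1≤) (theta-product 2 6 2 1≤ 1≤ 1≤)) ⟨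
    q * (T 7 13 * T 3 17 * (T 14 6 * T 2 18)) ∎
    where
    P₂ = theta 1# 4 36
    Q₂ = theta 1# 24 16
    P₅ = theta 1# 10 30
    Q₅ = theta 1# 30 10
    P₆ = theta 1# 12 28
    Q₆ = theta 1# 32 8
    P₈ = theta 1# 16 24
    Q₈ = theta 1# 36 4

  -- Every product has four thetas, so the unit (q²⁰; q²⁰)_∞ occurs to the fourth power throughout
  -- and cancels.
  weierstrass-poch : Θ 13 7 * Θ 3 17 * (Θ 8 12 * Θ 4 16) - Θ 10 10 * Θ 6 14 * (Θ 11 9 * Θ 1 19)
                   ≈ q * (Θ 7 13 * Θ 3 17 * (Θ 14 6 * Θ 2 18))
  weierstrass-poch = cancelˡ (invertible-* (invertible-* f⁻¹ f⁻¹) (invertible-* f⁻¹ f⁻¹)) (begin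
    f * f * (f * f) * (Θ 13 7 * Θ 3 17 * (Θ 8 12 * Θ 4 16) - Θ 10 10 * Θ 6 14 * (Θ 11 9 * Θ 1 19))
      ≈⟨ solve 9 (λ f a b c d a′ b′ c′ d′ → f :* f :* (f :* f) :* (a :* b :* (c :* d) :- a′ :* b′ :* (c′ :* d′))
           := f :* a :* (f :* b) :* (f :* c :* (f :* d)) :- f :* a′ :* (f :* b′) :* (f :* c′ :* (f :* d′)))
           refl _ _ _ _ _ _ _ _ _ ⟩
    f * Θ 13 7 * (f * Θ 3 17) * (f * Θ 8 12 * (f * Θ 4 16)) - f * Θ 10 10 * (f * Θ 6 14) * (f * Θ 11 9 * (f * Θ 1 19))
      ≈⟨ +-cong (*-cong (*-cong (theta₋-product 13 7 1≤ 1≤) (theta₋-product 3 17 1≤ 1≤)) (*-cong (theta₋-product 8 12 1≤ 1≤) (theta₋-product 4 16 1≤ 1≤)))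
          (-‿cong (*-cong (*-cong (theta₋-product 10 10 1≤ 1≤) (theta₋-product 6 14 1≤ 1≤)) (*-cong (theta₋-product 11 9 1≤ 1≤) (theta₋-product 1 19 1≤ 1≤)))) ⟨
    T 13 7 * T 3 17 * (T 8 12 * T 4 16) - T 10 10 * T 6 14 * (T 11 9 * T 1 19)
      ≈⟨ weierstrass ⟩
    q * (T 7 13 * T 3 17 * (T 14 6 * T 2 18))
      ≈⟨ *-congˡ (*-cong (*-cong (theta₋-product 7 13 1≤ 1≤) (theta₋-product 3 17 1≤ 1≤)) (*-cong (theta₋-product 14 6 1≤ 1≤) (theta₋-product 2 18 1≤ 1≤))) ⟩
    q * (f * Θ 7 13 * (f * Θ 3 17) * (f * Θ 14 6 * (f * Θ 2 18)))
      ≈⟨ solve 6 (λ f q a b c d → q :* (f :* a :* (f :* b) :* (f :* c :* (f :* d))) := f :* f :* (f :* f) :* (q :* (a :* b :* (c :* d))))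
           refl _ _ _ _ _ _ ⟩
    f * f * (f * f) * (q * (Θ 7 13 * Θ 3 17 * (Θ 14 6 * Θ 2 18))) ∎)
    where f⁻¹ = invertible-poch 20 20 1≤

  -- The multiplier `U` contains the denominator of the claim and the classes 6, 10, 14 modulo 20.
  -- These complete the classes 2 and 18 of the denominator to (q²; q⁴)_∞, while class 10 alone is
  -- (q¹⁰; q²⁰)_∞: the denominators of ψ(q²) and ψ(q¹⁰) in Gauss' product.
  psi-difference : ∀ {g₂ g₃} → g₂ * poch 2 5 ≈ 1# → g₃ * poch 3 5 ≈ 1# →
    psi 1 - q * psi 5 ≈ poch 1 10 * poch 9 10 * poch 10 10 * poch 8 20 * poch 12 20 * g₂ * g₃
  psi-difference {g₂} {g₃} inv₂ inv₃ = cancelˡ U⁻¹ (begin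
    U * (psi 1 - q * psi 5)
      ≈⟨ *-congʳ (*-congʳ (*-cong (poch-split 3 2 5 1≤) (poch-split 3 3 5 1≤))) ⟩
    1# * p 2 * p 7 * p 12 * p 17 * (1# * p 3 * p 8 * p 13 * p 18) * (p 6 * p 14 * p 10) * (psi 1 - q * psi 5)
      ≈⟨ solve 14 (λ p₂ p₃ p₆ p₇ p₈ p₁₀ p₁₂ p₁₃ p₁₄ p₁₇ p₁₈ q ψ₁ ψ₅ →
           con (+ 1) :* p₂ :* p₇ :* p₁₂ :* p₁₇ :* (con (+ 1) :* p₃ :* p₈ :* p₁₃ :* p₁₈) :* (p₆ :* p₁₄ :* p₁₀) :* (ψ₁ :- q :* ψ₅)
           := (ψ₁ :* (con (+ 1) :* p₂ :* p₆ :* p₁₀ :* p₁₄ :* p₁₈)) :* (p₇ :* p₁₃ :* (p₁₇ :* p₃) :* (p₁₂ :* p₈))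
              :- q :* (ψ₅ :* p₁₀) :* (p₁₃ :* p₇ :* (p₁₇ :* p₃) :* (p₆ :* p₁₄ :* (p₁₈ :* p₂))) :* (p₁₂ :* p₈))
           refl (p 2) (p 3) (p 6) (p 7) (p 8) (p 10) (p 12) (p 13) (p 14) (p 17) (p 18) q (psi 1) (psi 5) ⟩
    psi 1 * (1# * p 2 * p 6 * p 10 * p 14 * p 18) * (Θ 13 7 * Θ 3 17 * Θ 8 12)
      - q * (psi 5 * p 10) * (Θ 7 13 * Θ 3 17 * (Θ 14 6 * Θ 2 18)) * Θ 8 12
      ≈⟨ +-cong (*-congʳ (trans (*-congˡ (sym (poch-split 4 2 4 1≤))) (trans (psi-product 1 1≤) (poch-split 4 4 4 1≤))))
                (-‿cong (*-congʳ (*-congʳ (*-congˡ (psi-product 5 1≤))))) ⟩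
    1# * p 4 * p 8 * p 12 * p 16 * f * (Θ 13 7 * Θ 3 17 * Θ 8 12)
      - q * f * (Θ 7 13 * Θ 3 17 * (Θ 14 6 * Θ 2 18)) * Θ 8 12
      -- The numerator (q⁴; q⁴)_∞ of ψ(q²) is Θ₄ Θ₈ (q²⁰; q²⁰)_∞, so (q²⁰; q²⁰)_∞ Θ₈ splits off both
      -- terms and leaves two of the three terms of Weierstrass' relation.
      ≈⟨ solve 9 (λ p₄ p₈ p₁₂ p₁₆ f q a b X →
           con (+ 1) :* p₄ :* p₈ :* p₁₂ :* p₁₆ :* f :* (a :* b :* (p₁₂ :* p₈)) :- q :* f :* X :* (p₁₂ :* p₈)
           := f :* (p₁₂ :* p₈) :* (a :* b :* (p₁₂ :* p₈ :* (p₁₆ :* p₄)) :- q :* X))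
           refl (p 4) (p 8) (p 12) (p 16) f q (Θ 13 7) (Θ 3 17) _ ⟩
    f * Θ 8 12 * (Θ 13 7 * Θ 3 17 * (Θ 8 12 * Θ 4 16) - q * (Θ 7 13 * Θ 3 17 * (Θ 14 6 * Θ 2 18)))
      ≈⟨ *-congˡ (+-congˡ (-‿cong weierstrass-poch)) ⟨
    f * Θ 8 12 * (Θ 13 7 * Θ 3 17 * (Θ 8 12 * Θ 4 16)
      - (Θ 13 7 * Θ 3 17 * (Θ 8 12 * Θ 4 16) - Θ 10 10 * Θ 6 14 * (Θ 11 9 * Θ 1 19)))
      ≈⟨ *-congˡ (solve 2 (λ x y → x :- (x :- y) := y) refl _ _) ⟩
    f * Θ 8 12 * (Θ 10 10 * Θ 6 14 * (Θ 11 9 * Θ 1 19))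
      -- Θ₁₀ is a square: one copy of class 10 belongs to `U`, the other joins (q²⁰; q²⁰)_∞ to form
      -- (q¹⁰; q¹⁰)_∞.
      ≈⟨ solve 10 (λ f p₁ p₆ p₈ p₉ p₁₀ p₁₁ p₁₂ p₁₄ p₁₉ →
           f :* (p₁₂ :* p₈) :* (p₁₀ :* p₁₀ :* (p₁₄ :* p₆) :* (p₉ :* p₁₁ :* (p₁₉ :* p₁)))
           := con (+ 1) :* con (+ 1) :* (p₆ :* p₁₄ :* p₁₀) :* (con (+ 1) :* p₁ :* p₁₁ :* (con (+ 1) :* p₉ :* p₁₉) :* (con (+ 1) :* p₁₀ :* f) :* p₈ :* p₁₂))
           refl f (p 1) (p 6) (p 8) (p 9) (p 10) (p 11) (p 12) (p 14) (p 19) ⟩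
    1# * 1# * (p 6 * p 14 * p 10) * (1# * p 1 * p 11 * (1# * p 9 * p 19) * (1# * p 10 * f) * p 8 * p 12)
      ≈⟨ *-cong (*-congʳ (*-cong inv₂ inv₃))
           (*-congʳ (*-congʳ (*-cong (*-cong (poch-split 1 1 10 1≤) (poch-split 1 9 10 1≤)) (poch-split 1 10 10 1≤)))) ⟨
    g₂ * poch 2 5 * (g₃ * poch 3 5) * (p 6 * p 14 * p 10) * (poch 1 10 * poch 9 10 * poch 10 10 * p 8 * p 12)
      ≈⟨ solve 6 (λ g h x y u v → g :* x :* (h :* y) :* u :* v := x :* y :* u :* (v :* g :* h)) refl _ _ _ _ _ _ ⟩
    U * (poch 1 10 * poch 9 10 * poch 10 10 * poch 8 20 * poch 12 20 * g₂ * g₃) ∎)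
    where
    p : ℕ → Carrier
    p a = poch a 20
    U = poch 2 5 * poch 3 5 * (p 6 * p 14 * p 10)
    U⁻¹ : Invertible U
    U⁻¹ = invertible-* (invertible-* (invertible-poch 2 5 1≤) (invertible-poch 3 5 1≤))
      (invertible-* (invertible-* (invertible-poch 6 20 1≤) (invertible-poch 14 20 1≤)) (invertible-poch 10 20 1≤))

  psi-difference-sum : psi 1 - q * psi 5 ≈ sum N (λ i → q ^ (i ℕ.* suc i) - q ^ (5 ℕ.* (i ℕ.* suc i) ℕ.+ 1))
  psi-difference-sum = begin
    psi 1 - q * psi 5
      ≈⟨ +-congˡ (trans (-‿distribˡ-* _ _) (sym (sum-*ˡ (N ℕ.+ N) (- q) _))) ⟩
    psi 1 + sum (N ℕ.+ N) (λ i → - q * q ^ (5 ℕ.* (i ℕ.* suc i)))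
      ≈⟨ sum-+ (N ℕ.+ N) _ _ ⟨
    sum (N ℕ.+ N) (λ i → q ^ (1 ℕ.* (i ℕ.* suc i)) + - q * q ^ (5 ℕ.* (i ℕ.* suc i)))
      ≈⟨ sum-cong (N ℕ.+ N) (λ i _ → +-cong (^-congʳ q (ℕ.*-identityˡ (i ℕ.* suc i)))
           (trans (sym (-‿distribˡ-* _ _)) (-‿cong (^-congʳ q (ℕ.+-comm 1 (5 ℕ.* (i ℕ.* suc i))))))) ⟩
    sum (N ℕ.+ N) (λ i → q ^ (i ℕ.* suc i) - q ^ (5 ℕ.* (i ℕ.* suc i) ℕ.+ 1))
      ≈⟨ sum-stable N N _ vanishes ⟩
    sum N (λ i → q ^ (i ℕ.* suc i) - q ^ (5 ℕ.* (i ℕ.* suc i) ℕ.+ 1)) ∎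
    where
    vanishes : ∀ i → N ≤ i → q ^ (i ℕ.* suc i) - q ^ (5 ℕ.* (i ℕ.* suc i) ℕ.+ 1) ≈ 0#
    vanishes i N≤i = trans (+-cong (qᵉ≈0 _ N≤ii)
        (-‿cong (qᵉ≈0 _ (ℕ.≤-trans N≤ii (ℕ.≤-trans (ℕ.m≤n*m (i ℕ.* suc i) 5) (ℕ.m≤m+n _ 1))))))
      (-‿inverseʳ 0#)
      where N≤ii = ℕ.≤-trans N≤i (ℕ.m≤m*n i (suc i))

-- Ring laws of the Cauchy product

open import Defs

Σ<-front : ∀ m g → Σ< (suc m) g ≡ g 0 ℤ.+ Σ< m (λ k → g (suc k))
Σ<-front m g = ≡.cong (λ xs → g 0 ℤ.+ foldr ℤ._+_ 0ℤ xs)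
  (≡.trans (map-applyUpTo suc g m) (≡.sym (map-upTo (λ k → g (suc k)) m)))

Σ<-last : ∀ m g → Σ< (suc m) g ≡ Σ< m g ℤ.+ g m
Σ<-last zero    g = ℤ.+-comm (g 0) 0ℤ
Σ<-last (suc m) g = begin
  Σ< (suc (suc m)) g                               ≡⟨ Σ<-front (suc m) g ⟩
  g 0 ℤ.+ Σ< (suc m) (λ k → g (suc k))             ≡⟨ ≡.cong (λ s → g 0 ℤ.+ s) (Σ<-last m (λ k → g (suc k))) ⟩
  g 0 ℤ.+ (Σ< m (λ k → g (suc k)) ℤ.+ g (suc m))   ≡⟨ ℤ.+-assoc (g 0) _ _ ⟨
  g 0 ℤ.+ Σ< m (λ k → g (suc k)) ℤ.+ g (suc m)     ≡⟨ ≡.cong (ℤ._+ g (suc m)) (Σ<-front m g) ⟨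
  Σ< (suc m) g ℤ.+ g (suc m)                       ∎
  where open ≡.≡-Reasoning

shift : PS → PS
shift f n = f (suc n)

⊛-zero : ∀ f g → (f ⊛ g) 0 ≡ f 0 ℤ.* g 0
⊛-zero f g = ℤ.+-identityʳ _

-- This is f = f(0) + q · `shift f`. With it the ring laws follow by induction on the degree,
-- without rearranging double sums.
⊛-suc : ∀ f g n → (f ⊛ g) (suc n) ≡ f 0 ℤ.* g (suc n) ℤ.+ (shift f ⊛ g) n
⊛-suc f g n = Σ<-front (suc n) (λ k → f k ℤ.* g (suc n ∸ k))

-- Degree n of a product sees only degrees up to n of the factors; therefore multiplication respects
-- congruence modulo a power of q.
⊛-cong-≤ : ∀ n {f f′ g g′} → (∀ k → k ≤ n → f k ≡ f′ k) → (∀ k → k ≤ n → g k ≡ g′ k) → (f ⊛ g) n ≡ (f′ ⊛ g′) n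
⊛-cong-≤ zero {f} {f′} {g} {g′} f≡ g≡ =
  ≡.trans (⊛-zero f g) (≡.trans (≡.cong₂ ℤ._*_ (f≡ 0 z≤n) (g≡ 0 z≤n)) (≡.sym (⊛-zero f′ g′)))
⊛-cong-≤ (suc n) {f} {f′} {g} {g′} f≡ g≡ = ≡.trans (⊛-suc f g n) (≡.trans
  (≡.cong₂ ℤ._+_ (≡.cong₂ ℤ._*_ (f≡ 0 z≤n) (g≡ (suc n) ℕ.≤-refl))
    (⊛-cong-≤ n (λ k k≤n → f≡ (suc k) (s≤s k≤n)) (λ k k≤n → g≡ k (ℕ.m≤n⇒m≤1+n k≤n))))
  (≡.sym (⊛-suc f′ g′ n)))

-- The mirror image of `⊛-suc`, peeling the right factor; comparing the two recursions gives
-- commutativity.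
⊛-suc′ : ∀ f g n → (f ⊛ g) (suc n) ≡ f (suc n) ℤ.* g 0 ℤ.+ (f ⊛ shift g) n
⊛-suc′ f g zero = begin
  (f ⊛ g) 1                                     ≡⟨ ⊛-suc f g 0 ⟩
  f 0 ℤ.* g 1 ℤ.+ (shift f ⊛ g) 0               ≡⟨ ≡.cong (λ x → f 0 ℤ.* g 1 ℤ.+ x) (⊛-zero (shift f) g) ⟩
  f 0 ℤ.* g 1 ℤ.+ f 1 ℤ.* g 0                   ≡⟨ ℤ.+-comm (f 0 ℤ.* g 1) _ ⟩
  f 1 ℤ.* g 0 ℤ.+ f 0 ℤ.* g 1                   ≡⟨ ≡.cong (λ x → f 1 ℤ.* g 0 ℤ.+ x) (⊛-zero f (shift g)) ⟨
  f 1 ℤ.* g 0 ℤ.+ (f ⊛ shift g) 0               ∎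
  where open ≡.≡-Reasoning
⊛-suc′ f g (suc n) = begin
  (f ⊛ g) (suc (suc n))
    ≡⟨ ⊛-suc f g (suc n) ⟩
  f 0 ℤ.* g (suc (suc n)) ℤ.+ (shift f ⊛ g) (suc n)
    ≡⟨ ≡.cong (λ x → f 0 ℤ.* g (suc (suc n)) ℤ.+ x) (⊛-suc′ (shift f) g n) ⟩
  f 0 ℤ.* g (suc (suc n)) ℤ.+ (f (suc (suc n)) ℤ.* g 0 ℤ.+ (shift f ⊛ shift g) n)
    ≡⟨ solve 3 (λ a b c → a :+ (b :+ c) := b :+ (a :+ c)) ≡.refl
         (f 0 ℤ.* g (suc (suc n))) (f (suc (suc n)) ℤ.* g 0) ((shift f ⊛ shift g) n) ⟩
  f (suc (suc n)) ℤ.* g 0 ℤ.+ (f 0 ℤ.* g (suc (suc n)) ℤ.+ (shift f ⊛ shift g) n)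
    ≡⟨ ≡.cong (λ x → f (suc (suc n)) ℤ.* g 0 ℤ.+ x) (⊛-suc f (shift g) n) ⟨
  f (suc (suc n)) ℤ.* g 0 ℤ.+ (f ⊛ shift g) (suc n) ∎
  where
  open ≡.≡-Reasoning
  open ℤ.+-*-Solver

⊛-comm : ∀ f g n → (f ⊛ g) n ≡ (g ⊛ f) n
⊛-comm f g zero    = ≡.trans (⊛-zero f g) (≡.trans (ℤ.*-comm (f 0) (g 0)) (≡.sym (⊛-zero g f)))
⊛-comm f g (suc n) = ≡.trans (⊛-suc f g n) (≡.trans
  (≡.cong₂ ℤ._+_ (ℤ.*-comm (f 0) (g (suc n))) (⊛-comm (shift f) g n)) (≡.sym (⊛-suc′ g f n)))

⊛-distribʳ : ∀ h f g n → ((f ⊕ g) ⊛ h) n ≡ (f ⊛ h) n ℤ.+ (g ⊛ h) n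
⊛-distribʳ h f g zero = ≡.trans (⊛-zero (f ⊕ g) h) (≡.trans (ℤ.*-distribʳ-+ (h 0) (f 0) (g 0))
  (≡.sym (≡.cong₂ ℤ._+_ (⊛-zero f h) (⊛-zero g h))))
⊛-distribʳ h f g (suc n) = begin
  ((f ⊕ g) ⊛ h) (suc n)
    ≡⟨ ⊛-suc (f ⊕ g) h n ⟩
  (f 0 ℤ.+ g 0) ℤ.* h (suc n) ℤ.+ ((shift f ⊕ shift g) ⊛ h) n
    ≡⟨ ≡.cong (λ x → (f 0 ℤ.+ g 0) ℤ.* h (suc n) ℤ.+ x) (⊛-distribʳ h (shift f) (shift g) n) ⟩
  (f 0 ℤ.+ g 0) ℤ.* h (suc n) ℤ.+ ((shift f ⊛ h) n ℤ.+ (shift g ⊛ h) n)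
    ≡⟨ solve 5 (λ a b c x y → (a :+ b) :* c :+ (x :+ y) := (a :* c :+ x) :+ (b :* c :+ y)) ≡.refl
         (f 0) (g 0) (h (suc n)) ((shift f ⊛ h) n) ((shift g ⊛ h) n) ⟩
  (f 0 ℤ.* h (suc n) ℤ.+ (shift f ⊛ h) n) ℤ.+ (g 0 ℤ.* h (suc n) ℤ.+ (shift g ⊛ h) n)
    ≡⟨ ≡.cong₂ ℤ._+_ (⊛-suc f h n) (⊛-suc g h n) ⟨
  (f ⊛ h) (suc n) ℤ.+ (g ⊛ h) (suc n) ∎
  where
  open ≡.≡-Reasoning
  open ℤ.+-*-Solver

⊛-scale : ∀ c f g n → ((λ k → c ℤ.* f k) ⊛ g) n ≡ c ℤ.* (f ⊛ g) n
⊛-scale c f g zero = ≡.trans (⊛-zero (λ k → c ℤ.* f k) g)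
  (≡.trans (ℤ.*-assoc c (f 0) (g 0)) (≡.cong (c ℤ.*_) (≡.sym (⊛-zero f g))))
⊛-scale c f g (suc n) = begin
  ((λ k → c ℤ.* f k) ⊛ g) (suc n)
    ≡⟨ ⊛-suc (λ k → c ℤ.* f k) g n ⟩
  c ℤ.* f 0 ℤ.* g (suc n) ℤ.+ ((λ k → c ℤ.* shift f k) ⊛ g) n
    ≡⟨ ≡.cong (λ x → c ℤ.* f 0 ℤ.* g (suc n) ℤ.+ x) (⊛-scale c (shift f) g n) ⟩
  c ℤ.* f 0 ℤ.* g (suc n) ℤ.+ c ℤ.* (shift f ⊛ g) n
    ≡⟨ solve 4 (λ c a b x → c :* a :* b :+ c :* x := c :* (a :* b :+ x)) ≡.refl c (f 0) (g (suc n)) ((shift f ⊛ g) n) ⟩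
  c ℤ.* (f 0 ℤ.* g (suc n) ℤ.+ (shift f ⊛ g) n)
    ≡⟨ ≡.cong (c ℤ.*_) (⊛-suc f g n) ⟨
  c ℤ.* (f ⊛ g) (suc n) ∎
  where
  open ≡.≡-Reasoning
  open ℤ.+-*-Solver

⊛-assoc : ∀ f g h n → ((f ⊛ g) ⊛ h) n ≡ (f ⊛ (g ⊛ h)) n
⊛-assoc f g h zero = begin
  ((f ⊛ g) ⊛ h) 0             ≡⟨ ⊛-zero (f ⊛ g) h ⟩
  (f ⊛ g) 0 ℤ.* h 0           ≡⟨ ≡.cong (ℤ._* h 0) (⊛-zero f g) ⟩
  f 0 ℤ.* g 0 ℤ.* h 0         ≡⟨ ℤ.*-assoc (f 0) (g 0) (h 0) ⟩
  f 0 ℤ.* (g 0 ℤ.* h 0)       ≡⟨ ≡.cong (f 0 ℤ.*_) (⊛-zero g h) ⟨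
  f 0 ℤ.* (g ⊛ h) 0           ≡⟨ ⊛-zero f (g ⊛ h) ⟨
  (f ⊛ (g ⊛ h)) 0             ∎
  where open ≡.≡-Reasoning
⊛-assoc f g h (suc n) = begin
  ((f ⊛ g) ⊛ h) (suc n)
    ≡⟨ ⊛-suc (f ⊛ g) h n ⟩
  (f ⊛ g) 0 ℤ.* h (suc n) ℤ.+ (shift (f ⊛ g) ⊛ h) n
    ≡⟨ ≡.cong₂ (λ x y → x ℤ.* h (suc n) ℤ.+ y) (⊛-zero f g) 
       (⊛-cong-≤ n {g = h} {h} (λ k _ → ⊛-suc f g k) (λ _ _ → ≡.refl)) ⟩
  f 0 ℤ.* g 0 ℤ.* h (suc n) ℤ.+ (((λ k → f 0 ℤ.* shift g k) ⊕ (shift f ⊛ g)) ⊛ h) n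
    ≡⟨ ≡.cong (λ x → f 0 ℤ.* g 0 ℤ.* h (suc n) ℤ.+ x) (⊛-distribʳ h (λ k → f 0 ℤ.* shift g k) (shift f ⊛ g) n) ⟩
  f 0 ℤ.* g 0 ℤ.* h (suc n) ℤ.+ (((λ k → f 0 ℤ.* shift g k) ⊛ h) n ℤ.+ ((shift f ⊛ g) ⊛ h) n)
    ≡⟨ ≡.cong₂ (λ x y → f 0 ℤ.* g 0 ℤ.* h (suc n) ℤ.+ (x ℤ.+ y)) (⊛-scale (f 0) (shift g) h n) (⊛-assoc (shift f) g h n) ⟩
  f 0 ℤ.* g 0 ℤ.* h (suc n) ℤ.+ (f 0 ℤ.* (shift g ⊛ h) n ℤ.+ (shift f ⊛ (g ⊛ h)) n)
    ≡⟨ solve 5 (λ a b c x y → a :* b :* c :+ (a :* x :+ y) := a :* (b :* c :+ x) :+ y) ≡.refl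
         (f 0) (g 0) (h (suc n)) ((shift g ⊛ h) n) ((shift f ⊛ (g ⊛ h)) n) ⟩
  f 0 ℤ.* (g 0 ℤ.* h (suc n) ℤ.+ (shift g ⊛ h) n) ℤ.+ (shift f ⊛ (g ⊛ h)) n
    ≡⟨ ≡.cong (λ x → f 0 ℤ.* x ℤ.+ (shift f ⊛ (g ⊛ h)) n) (⊛-suc g h n) ⟨
  f 0 ℤ.* (g ⊛ h) (suc n) ℤ.+ (shift f ⊛ (g ⊛ h)) n
    ≡⟨ ⊛-suc f (g ⊛ h) n ⟨
  (f ⊛ (g ⊛ h)) (suc n) ∎
  where
  open ≡.≡-Reasoning
  open ℤ.+-*-Solver

0⊛ : ∀ f n → ((λ _ → 0ℤ) ⊛ f) n ≡ 0ℤ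
0⊛ f zero    = ⊛-zero (λ _ → 0ℤ) f
0⊛ f (suc n) = ≡.trans (⊛-suc (λ _ → 0ℤ) f n) (≡.trans (ℤ.+-identityˡ _) (0⊛ f n))

⊛-identityˡ : ∀ f n → (one ⊛ f) n ≡ f n
⊛-identityˡ f zero    = ≡.trans (⊛-zero one f) (ℤ.*-identityˡ (f 0))
⊛-identityˡ f (suc n) = ≡.trans (⊛-suc one f n) (≡.trans
  (≡.cong₂ ℤ._+_ (ℤ.*-identityˡ (f (suc n))) (0⊛ f n)) (ℤ.+-identityʳ _))

-- Power series modulo a power of q

record _≈[_]_ (f : PS) (N : ℕ) (g : PS) : Set where
  constructor below
  field coefficient : ∀ n → n < N → f n ≡ g n

open _≈[_]_

pointwise : ∀ {N f g} → (∀ n → f n ≡ g n) → f ≈[ N ] g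
pointwise f≡g = below λ n _ → f≡g n

-- The quotient by q^N as a setoid: only equality is coarsened, the elements and operations are
-- those of full power series, so the series of the theorem are elements as they stand.
truncated : ℕ → CommutativeRing 0ℓ 0ℓ
truncated N = record
  { Carrier = PS ; _≈_ = _≈[ N ]_ ; _+_ = _⊕_ ; _*_ = _⊛_ ; -_ = λ f n → ℤ.- f n ; 0# = λ _ → 0ℤ ; 1# = one
  ; isCommutativeRing = record
    { isRing = record
      { +-isAbelianGroup = record
        { isGroup = record
          { isMonoid = record
            { isSemigroup = record
              { isMagma = record
                { isEquivalence = record
                  { refl  = pointwise λ _ → ≡.refl
                  ; sym   = λ p → below λ n n<N → ≡.sym (coefficient p n n<N)
                  ; trans = λ p r → below λ n n<N → ≡.trans (coefficient p n n<N) (coefficient r n n<N)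
                  }
                ; ∙-cong = λ p r → below λ n n<N → ≡.cong₂ ℤ._+_ (coefficient p n n<N) (coefficient r n n<N)
                }
              ; assoc = λ f g h → pointwise λ n → ℤ.+-assoc (f n) (g n) (h n)
              }
            ; identity = (λ f → pointwise λ n → ℤ.+-identityˡ (f n)) , (λ f → pointwise λ n → ℤ.+-identityʳ (f n))
            }
          ; inverse = (λ f → pointwise λ n → ℤ.+-inverseˡ (f n)) , (λ f → pointwise λ n → ℤ.+-inverseʳ (f n))
          ; ⁻¹-cong = λ p → below λ n n<N → ≡.cong ℤ.-_ (coefficient p n n<N)
          }
        ; comm = λ f g → pointwise λ n → ℤ.+-comm (f n) (g n)
        }
      ; *-cong = λ p r → below λ n n<N → ⊛-cong-≤ n (λ k k≤n → coefficient p k (ℕ.≤-<-trans k≤n n<N))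
                                                     (λ k k≤n → coefficient r k (ℕ.≤-<-trans k≤n n<N))
      ; *-assoc = λ f g h → pointwise (⊛-assoc f g h)
      ; *-identity = (λ f → pointwise (⊛-identityˡ f))
                   , (λ f → pointwise λ n → ≡.trans (⊛-comm f one n) (⊛-identityˡ f n))
      ; distrib = (λ h f g → pointwise λ n → ≡.trans (⊛-comm h (f ⊕ g) n) (≡.trans (⊛-distribʳ h f g n)
                    (≡.cong₂ ℤ._+_ (⊛-comm f h n) (⊛-comm g h n))))
                , (λ h f g → pointwise (⊛-distribʳ h f g))
      }
    ; *-comm = λ f g → pointwise (⊛-comm f g)
    }
  }

-- Monomials and geometric series

if-T : ∀ b → Bool.T b → (if b then 1ℤ else 0ℤ) ≡ 1ℤ
if-T true _ = ≡.refl

if-¬T : ∀ b → ¬ Bool.T b → (if b then 1ℤ else 0ℤ) ≡ 0ℤ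
if-¬T true  ¬t = ⊥-elim (¬t _)
if-¬T false _  = ≡.refl

mono-≢ : ∀ {e n} → e ≢ n → mono e n ≡ 0ℤ
mono-≢ {e} {n} e≢n = if-¬T (e ≡ᵇ n) λ t → e≢n (ℕ.≡ᵇ⇒≡ e n t)

mono-zero : ∀ n → mono 0 n ≡ one n
mono-zero zero    = ≡.refl
mono-zero (suc n) = ≡.refl

mono-suc-⊛ : ∀ e f n → (mono (suc e) ⊛ f) (suc n) ≡ (mono e ⊛ f) n
mono-suc-⊛ e f n = ≡.trans (⊛-suc (mono (suc e)) f n) (ℤ.+-identityˡ _)

mono-⊛-below : ∀ e f n → n < e → (mono e ⊛ f) n ≡ 0ℤ
mono-⊛-below (suc e) f zero    _         = ⊛-zero (mono (suc e)) f
mono-⊛-below (suc e) f (suc n) (s≤s n<e) = ≡.trans (mono-suc-⊛ e f n) (mono-⊛-below e f n n<e)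

mono-⊛-shift : ∀ e f n → (mono e ⊛ f) (e ℕ.+ n) ≡ f n
mono-⊛-shift zero    f n = ≡.trans (⊛-cong-≤ n {g = f} {f} (λ k _ → mono-zero k) (λ _ _ → ≡.refl)) (⊛-identityˡ f n)
mono-⊛-shift (suc e) f n = ≡.trans (mono-suc-⊛ e f (e ℕ.+ n)) (mono-⊛-shift e f n)

mono-1-⊛ : ∀ e n → (mono 1 ⊛ mono e) n ≡ mono (suc e) n
mono-1-⊛ e zero    = mono-⊛-below 1 (mono e) 0 (s≤s z≤n)
mono-1-⊛ e (suc n) = mono-⊛-shift 1 (mono e) n

geom-∣ : ∀ {m n} → 1 ≤ m → m ∣ n → geom m n ≡ 1ℤ
geom-∣ {m} {n} 1≤m (divides j n≡jm) = if-T _ (any⁺ (λ j → (m ℕ.* j) ≡ᵇ n)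
  (lose (∈-upTo⁺ (s≤s j≤n)) (ℕ.≡⇒≡ᵇ (m ℕ.* j) n mj≡n)))
  where
  mj≡n = ≡.trans (ℕ.*-comm m j) (≡.sym n≡jm)
  j≤n : j ≤ n
  j≤n = ℕ.≤-trans (ℕ.≤-reflexive (≡.sym (ℕ.*-identityˡ j))) (ℕ.≤-trans (ℕ.*-monoˡ-≤ j 1≤m) (ℕ.≤-reflexive mj≡n))

geom-∤ : ∀ {m n} → m ∤ n → geom m n ≡ 0ℤ
geom-∤ {m} {n} m∤n = if-¬T _ λ t → case find (any⁻ (λ j → (m ℕ.* j) ≡ᵇ n) (upTo (suc n)) t) of
  λ { (j , _ , mj≡n) → m∤n (divides j (≡.trans (≡.sym (ℕ.≡ᵇ⇒≡ (m ℕ.* j) n mj≡n)) (ℕ.*-comm m j))) }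

geom-below : ∀ {m n} → 1 ≤ m → n < m → geom m n ≡ one n
geom-below {m} {zero}  1≤m n<m = geom-∣ 1≤m (m ∣0)
geom-below {m} {suc n} 1≤m n<m = geom-∤ (>⇒∤ n<m)

geom-shift : ∀ {m} n → 1 ≤ m → geom m (m ℕ.+ n) ≡ geom m n
geom-shift {m} n 1≤m with m ∣? n
... | yes m∣n = ≡.trans (geom-∣ 1≤m (∣m∣n⇒∣m+n ∣-refl m∣n)) (≡.sym (geom-∣ 1≤m m∣n))
... | no  m∤n = ≡.trans (geom-∤ (λ m∣m+n → m∤n (∣m+n∣m⇒∣n m∣m+n ∣-refl))) (≡.sym (geom-∤ m∤n))

-- The coefficients of `geom m` indicate divisibility by m, hence are periodic with period m; below
-- degree m only the constant term is left.
mono-⊛-geom : ∀ {m} n → 1 ≤ m → geom m n ≡ one n ℤ.+ (mono m ⊛ geom m) n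
mono-⊛-geom {m} n 1≤m with ℕ.<-≤-connex n m
... | inj₁ n<m = ≡.trans (geom-below 1≤m n<m) (≡.trans (≡.sym (ℤ.+-identityʳ (one n)))
  (≡.cong (λ x → one n ℤ.+ x) (≡.sym (mono-⊛-below m (geom m) n n<m))))
... | inj₂ m≤n = ≡.subst (λ n → geom m n ≡ one n ℤ.+ (mono m ⊛ geom m) n) (ℕ.m+[n∸m]≡n m≤n) (begin
  geom m (m ℕ.+ k)                                          ≡⟨ geom-shift k 1≤m ⟩
  geom m k                                                  ≡⟨ mono-⊛-shift m (geom m) k ⟨
  (mono m ⊛ geom m) (m ℕ.+ k)                               ≡⟨ ℤ.+-identityˡ _ ⟨
  0ℤ ℤ.+ (mono m ⊛ geom m) (m ℕ.+ k)                        ≡⟨ ≡.cong (ℤ._+ (mono m ⊛ geom m) (m ℕ.+ k)) (one-pos 1≤m) ⟨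
  one (m ℕ.+ k) ℤ.+ (mono m ⊛ geom m) (m ℕ.+ k)             ∎)
  where
  open ≡.≡-Reasoning
  k = n ∸ m
  one-pos : ∀ {m k} → 1 ≤ m → one (m ℕ.+ k) ≡ 0ℤ
  one-pos (s≤s _) = ≡.refl

-- The products of the theorem are cut at a length depending on the degree n, those of the ring at a
-- fixed N. Modulo q^(n+1) the additional factors are 1, so the comparison takes place in that ring.
Π<-coefficient : ∀ {F : ℕ → PS} → (∀ i n → n ≤ i → F i n ≡ one n) → ∀ {N} n → n < N → Π< (suc n) F n ≡ Π< N F n
Π<-coefficient {F} F≡one {N} n n<N = coefficient same n (ℕ.n<1+n n)
  where
  open CommutativeRing (truncated (suc n)) using (reflexive; trans; sym)
  open Sums (truncated (suc n))
  Π<-prod : ∀ m → Π< m F ≡ prod m F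
  Π<-prod zero    = ≡.refl
  Π<-prod (suc m) = ≡.cong (_⊛ F m) (Π<-prod m)
  same : Π< (suc n) F ≈[ suc n ] Π< N F
  same = trans (reflexive (Π<-prod (suc n))) (sym (trans
    (reflexive (≡.trans (Π<-prod N) (≡.cong (λ k → prod k F) (≡.sym (ℕ.m∸n+n≡m n<N)))))
    (prod-stable (N ∸ suc n) (suc n) F λ i n<i → below λ k k≤n → F≡one i k (ℕ.≤-trans (ℕ.s≤s⁻¹ k≤n) (ℕ.<⇒≤ n<i)))))

-- Transfer to the series of the theorem

module Truncation (N : ℕ) where
  open CommutativeRing (truncated N) hiding (zero)
  open Exp semiring
  open Sums (truncated N)
  open import Relation.Binary.Reasoning.Setoid setoid

  q^≈mono : ∀ e → mono 1 ^ e ≈ mono e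
  q^≈mono zero    = pointwise λ n → ≡.sym (mono-zero n)
  q^≈mono (suc e) = trans (*-congˡ {mono 1} (q^≈mono e)) (pointwise (mono-1-⊛ e))

  mono-vanishes : ∀ e → N ≤ e → mono e ≈ 0#
  mono-vanishes e N≤e = below λ n n<N → mono-≢ λ e≡n → ℕ.<⇒≱ n<N (ℕ.≤-trans N≤e (ℕ.≤-reflexive e≡n))

  q^-vanishes : ∀ e → N ≤ e → mono 1 ^ e ≈ 0#
  q^-vanishes e N≤e = trans (q^≈mono e) (mono-vanishes e N≤e)

  module Q = NilpotentTheta (truncated N) (mono 1) N q^-vanishes
  module Ψ = ThetaIdentities (truncated N) (mono 1) N q^-vanishes
  open PsiDifference (truncated N) (mono 1) N q^-vanishes

  Π<-prod : ∀ m {F G : ℕ → PS} → (∀ i → F i ≈ G i) → Π< m F ≈ prod m G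
  Π<-prod zero    F≈G = refl
  Π<-prod (suc m) F≈G = *-cong (Π<-prod m F≈G) (F≈G m)

  exceeds : ∀ {a k} → 1 ≤ a → 1 ≤ k → ∀ {n} i → n ≤ i → n < a ℕ.+ k ℕ.* i
  exceeds 1≤a 1≤k i n≤i = ℕ.+-mono-≤ 1≤a (ℕ.≤-trans n≤i
    (ℕ.≤-trans (ℕ.≤-reflexive (≡.sym (ℕ.*-identityˡ i))) (ℕ.*-monoˡ-≤ i 1≤k)))

  poch≈ : ∀ a k → 1 ≤ a → 1 ≤ k → poch a k ≈ Q.poch a k
  poch≈ a k 1≤a 1≤k = trans
    (below (Π<-coefficient λ i n n≤i → ≡.trans
      (≡.cong (λ x → one n ℤ.- x) (mono-≢ λ e≡n → ℕ.<⇒≢ (exceeds 1≤a 1≤k i n≤i) (≡.sym e≡n)))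
      (ℤ.+-identityʳ (one n))))
    (Π<-prod N λ i → +-congˡ {one} (-‿cong (sym (q^≈mono (a ℕ.+ k ℕ.* i)))))

  -- Factor by factor the geometric series inverts 1 - q^(a + k i). This is the form in which
  -- `psi-difference` takes the denominators.
  invPoch-inverse : ∀ a k → 1 ≤ a → 1 ≤ k → invPoch a k * Q.poch a k ≈ 1#
  invPoch-inverse a k 1≤a 1≤k = trans
    (*-congʳ {Q.poch a k} {invPoch a k} {prod N (λ i → geom (e i))} (trans
      (below (Π<-coefficient λ i n n≤i → geom-below (1≤e i) (exceeds 1≤a 1≤k i n≤i)))
      (Π<-prod N λ i → refl)))
    (prod-inverse N λ i → geometric-inverse (q^≈mono (e i)) (pointwise λ n → mono-⊛-geom n (1≤e i)))
    where
    e : ℕ → ℕ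
    e i = a ℕ.+ k ℕ.* i
    1≤e : ∀ i → 1 ≤ e i
    1≤e i = ℕ.≤-trans 1≤a (ℕ.m≤m+n a (k ℕ.* i))

  lhsTerm : ℕ → PS
  lhsTerm n = mono (n ℕ.* suc n) ⊖ mono (5 ℕ.* (n ℕ.* suc n) ℕ.+ 1)

  sum-coefficient : ∀ m (F : ℕ → PS) n → sum m F n ≡ Σ< m (λ i → F i n)
  sum-coefficient zero    F n = ≡.refl
  sum-coefficient (suc m) F n =
    ≡.trans (≡.cong (ℤ._+ F m n) (sum-coefficient m F n)) (≡.sym (Σ<-last m (λ i → F i n)))

  psi-difference≈lhs : Ψ.psi 1 - mono 1 * Ψ.psi 5 ≈ sum N lhsTerm
  psi-difference≈lhs = trans psi-difference-sum (sum-cong N λ i _ →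
    +-cong (q^≈mono (i ℕ.* suc i)) (-‿cong (q^≈mono (5 ℕ.* (i ℕ.* suc i) ℕ.+ 1))))

  rhs14≈ : rhs14 ≈ Ψ.psi 1 - mono 1 * Ψ.psi 5
  rhs14≈ = begin
    rhs14
      ≈⟨ *-congʳ (*-congʳ (*-cong (*-cong (*-cong (*-cong (poch≈ 1 10 1≤ 1≤) (poch≈ 9 10 1≤ 1≤)) (poch≈ 10 10 1≤ 1≤))
           (poch≈ 8 20 1≤ 1≤)) (poch≈ 12 20 1≤ 1≤))) ⟩
    Q.poch 1 10 * Q.poch 9 10 * Q.poch 10 10 * Q.poch 8 20 * Q.poch 12 20 * invPoch 2 5 * invPoch 3 5
      ≈⟨ psi-difference (invPoch-inverse 2 5 1≤ 1≤) (invPoch-inverse 3 5 1≤ 1≤) ⟨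
    Ψ.psi 1 - mono 1 * Ψ.psi 5 ∎
    where
    1≤ : ∀ {n} → 1 ≤ suc n
    1≤ = s≤s z≤n

theorem14 : (N : ℕ) → lhs14 N ≡ rhs14 N
theorem14 N = ≡.trans (≡.sym (sum-coefficient (suc N) lhsTerm N))
  (≡.sym (coefficient (trans rhs14≈ psi-difference≈lhs) N (ℕ.n<1+n N)))
  where
  -- Degree N is visible modulo q^(N+1), and `suc N` is also the number of terms that `lhs14` sums
  -- at N.
  open Truncation (suc N)
  open CommutativeRing (truncated (suc N)) using (trans)
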